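{- Let $0<\varepsilon<1$, fix an instance, an optimal schedule $\mathrm{OPT}$ for the total flow time objective, and a time $t$. Let $t_0\le t$ be such that $$\mathrm{vol}_{B(t_0)}(t_0)\ge \mathrm{vol}^*_{\mathrm{OPT}(t,t_0)}(t_0)\qquad\text{and}\qquad U(t_0)=F(t_0),$$ i.e., all unknown jobs at $t_0$ are frozen. Let $t_1\ge t_0$ (with $t_1\le t$) be such that: 1. at time $t_1$, the leader $L(t_1)\in U(t_1)\setminus F(t_1)$ with $e_{L(t_1)}(t_1)=\max_{j\in U(t_1)\setminus F(t_1)}e_j(t_1)$ is touched by SLF; 2. the set of frozen jobs does not change during $[t_0,t_1]$, that is, $F(t_0)=F(t')$ for all $t'\in[t_0,t_1]$; and 3. during $(t_0,t_1]$, there is always at least one new unknown job, that is, $|U(s)\setminus U(t_0)|\ge 1$ for all $s\in(t_0,t_1]$. (This implies that there is a new job arrival during $(t_0,t_1]$.) Then $\mathrm{vol}_{B(t_1)}(t_1)\ge\mathrm{vol}^*_{\mathrm{OPT}(t,t_1)}(t_1)$.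
   Context: **Problem.** An instance is a finite set of jobs. Job $j$ has a release (arrival) time $\ge 0$ and a processing time $p_j>0$. A single machine of unit speed processes the jobs; preemption is allowed at no cost, and the machine may be time-shared (job rates are nonnegative and sum to at most $1$). A job may only be processed after its release and completes when it has received $p_j$ units of processing. A job is active at time $s$ in a schedule if it has been released and is not finished at time $s$. The flow time of a job is its completion time minus its release time; an optimal schedule (computed offline) minimizes the sum of the flow times of all jobs. **Algorithm SLF (Shortest Lower-Bound First).** At time $s$, in the schedule of SLF, let $e_j(s)$ be the amount of processing job $j$ has received up to time $s$ and $r_j(s)=p_j-e_j(s)$ its remaining processing time. An active job $j$ is *known* at time $s$ if $r_j(s)\le \varepsilon p_j$ and *unknown* otherwise; $K(s)$ and $U(s)$ denote the sets of known and unknown active jobs. The estimate of an active job is $\eta_j(s)=\frac{\varepsilon}{1-\varepsilon}e_j(s)$ if $j\in U(s)$ and $\eta_j(s)=r_j(s)$ if $j\in K(s)$. At each time $s$ with at least one active job, SLF does the following, where a minimum over the empty set is $+\infty$: 1. If $\min_{j\in K(s)}\eta_j(s)\le\min_{j\in U(s)}\eta_j(s)$, it processes an arbitrary known job with minimum $\eta_j(s)$. 2. Otherwise, it processes all unknown jobs with minimum $\eta_j(s)$ in parallel at an equal rate (Round-Robin with infinitesimally small steps). A job is *touched* at time $s$ if it is among the jobs SLF processes at time $s$. **Standing assumptions.** SLF does not idle until time $t$, and neither SLF nor the optimal schedule idles unnecessarily (while there are active jobs). **Notation.** $\mathrm{SLF}(s)$ and $\mathrm{OPT}(s)$ are the sets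 of jobs active at time $s$ in SLF's and in the optimal schedule; for $s\le t$, $\mathrm{OPT}(t,s)=\mathrm{OPT}(t)\cap\mathrm{OPT}(s)$. $r^*_j(s)$ is the remaining processing time of $j$ at time $s$ in the optimal schedule; for a set $Q$ of jobs, $\mathrm{vol}_Q(s)=\sum_{j\in Q}r_j(s)$ and $\mathrm{vol}^*_Q(s)=\sum_{j\in Q}r^*_j(s)$. $B(s)$ is the set of the $\lceil 1/\varepsilon\rceil\cdot|\mathrm{OPT}(t,s)|$ jobs of $\mathrm{SLF}(s)$ with largest remaining processing time $r_j(s)$ (all of $\mathrm{SLF}(s)$ if there are fewer). **Frozen jobs and leader (relative to the fixed time $t$).** For $s\le t$, a job $j$ is *frozen* at time $s$ if it is unknown at time $s$ and not touched by SLF during $[s,t]$; $F(s)$ is the set of jobs frozen at time $s$. If $|U(s)\setminus F(s)|\ge 1$, the *leader* $L(s)$ is some job in $U(s)\setminus F(s)$ with $e_{L(s)}(s)=\max_{j\in U(s)\setminus F(s)}e_j(s)$. -}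

module Defs where

open import Algebra.Bundles using (CommutativeRing)
import Algebra.Definitions.RawMonoid as RawMonoidDefs
open import Data.Bool.Base using (if_then_else_)
open import Data.Fin.Base using (Fin)
open import Data.Fin.Subset using (Subset; _∈_; _∉_; _⊆_; _∩_; ∣_∣; ⁅_⁆)
import Data.Nat.Base as ℕ
open ℕ using (ℕ)
open import Data.Product.Base using (∃; ∃-syntax; _×_)
open import Data.Vec.Base using (lookup; tabulate)
open import Function.Bundles using (_⇔_)
open import Level using (0ℓ)
open import Relation.Binary.Bundles using (DecTotalOrder; StrictTotalOrder)
open import Relation.Binary.Core using (Rel)
import Relation.Binary.Properties.DecTotalOrder as DecTotalOrderProperties
open import Relation.Binary.PropositionalEquality.Core using (_≡_)
open import Relation.Binary.Structures using (IsDecTotalOrder)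
open import Relation.Nullary using (¬_; Dec; does)
open import Relation.Nullary.Decidable using (_×-dec_)
open import Relation.Unary using (Pred; _∖_)

-- The real numbers, axiomatised as a Dedekind-complete totally ordered field.
-- The order is decidable, as it is for the classical reals.
record Reals : Set₁ where
  infix 4 _≤_
  infix 9 _⁻¹
  field
    commutativeRing : CommutativeRing 0ℓ 0ℓ

  open CommutativeRing commutativeRing public

  field
    _≤_             : Rel Carrier 0ℓ
    isDecTotalOrder : IsDecTotalOrder _≈_ _≤_
    _⁻¹             : Carrier → Carrier
    0≉1             : ¬ 0# ≈ 1#
    -- Only the values of _⁻¹ away from 0# matter.
    ⁻¹-cong         : ∀ {x y} → x ≈ y → x ⁻¹ ≈ y ⁻¹
    ⁻¹-inverseʳ     : ∀ {x} → ¬ x ≈ 0# → x * x ⁻¹ ≈ 1#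
    +-monoʳ-≤       : ∀ x {y z} → y ≤ z → x + y ≤ x + z
    *-nonneg        : ∀ {x y} → 0# ≤ x → 0# ≤ y → 0# ≤ x * y
    supremum        : (S : Pred Carrier 0ℓ) → ∃ S →
                      (∃[ b ] ∀ x → S x → x ≤ b) →
                      ∃[ c ] (∀ x → S x → x ≤ c) ×
                             (∀ b → (∀ x → S x → x ≤ b) → c ≤ b)

  decTotalOrder : DecTotalOrder 0ℓ 0ℓ 0ℓ
  decTotalOrder = record { isDecTotalOrder = isDecTotalOrder }

  open IsDecTotalOrder isDecTotalOrder public using (_≤?_)
  open DecTotalOrderProperties decTotalOrder public using (_<_; <-strictTotalOrder)
  open StrictTotalOrder <-strictTotalOrder public using (_<?_)
  open RawMonoidDefs +-rawMonoid public using (sum) renaming (_×_ to _·_)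

  IsCeiling : Carrier → ℕ → Set
  IsCeiling x c = x ≤ c · 1# × (∀ m → x ≤ m · 1# → c ℕ.≤ m)

module Scheduling (ℝ : Reals) where
  open Reals ℝ

  record Instance : Set where
    field
      n         : ℕ
      release   : Fin n → Carrier
      size      : Fin n → Carrier
      release≥0 : ∀ j → 0# ≤ release j
      size>0    : ∀ j → 0# < size j

  open Instance using (n)

  -- A schedule is given by the cumulative processing received by each job.
  -- Nonnegative rates with total at most 1 amount to functions that are
  -- nondecreasing and whose total grows by at most the elapsed time.
  record Schedule (I : Instance) : Set where
    open Instance I using (release; size)
    field
      received       : Fin (n I) → Carrier → Carrier
      before-release : ∀ j s → s ≤ release j → received j s ≈ 0#
      monotone       : ∀ j {s s′} → s ≤ s′ → received j s ≤ received j s′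
      bounded        : ∀ j s → received j s ≤ size j
      unit-speed     : ∀ {s s′} → s ≤ s′ →
                       sum (λ j → received j s′ - received j s) ≤ s′ - s

  module _ {I : Instance} (S : Schedule I) where
    open Instance I using (release; size)
    open Schedule S

    remaining : Fin (n I) → Carrier → Carrier
    remaining j s = size j - received j s

    -- Jobs are released strictly before they become active: a job released
    -- at time s belongs to the active sets from immediately after s onwards,
    -- but not to the active set at s itself.  With release j ≤ s instead, no
    -- job could be new throughout a left-open interval (t₀ , t₁] without
    -- being active at t₀ already.
    Active : Carrier → Pred (Fin (n I)) 0ℓ
    Active s j = release j < s × 0# < remaining j s

    active? : ∀ s j → Dec (Active s j)
    active? s j = (release j <? s) ×-dec (0# <? remaining j s)

    activeSet : Carrier → Subset (n I)
    activeSet s = tabulate (λ j → does (active? s j))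

    activeAtBoth : Carrier → Carrier → Subset (n I)
    activeAtBoth t s = activeSet t ∩ activeSet s

    volume : Subset (n I) → Carrier → Carrier
    volume Q s = sum (λ j → if lookup Q j then remaining j s else 0#)

    -- Isolated instants without active jobs, as when one job completes
    -- exactly at the release of the next, do not count as idle time.
    NoIdlingUntil : Carrier → Set
    NoIdlingUntil t = ∀ s → 0# ≤ s → s ≤ t → sum (λ j → received j s) ≈ s

    NoUnnecessaryIdling : Set
    NoUnnecessaryIdling =
      ∀ {s s′} → 0# ≤ s → s ≤ s′ →
      (∀ u → s < u → u < s′ → ∃ (Active u)) →
      sum (λ j → received j s′ - received j s) ≈ s′ - s

    record Completion : Set where
      field
        completion : Fin (n I) → Carrier
        finished   : ∀ j → received j (completion j) ≈ size j
        unfinished : ∀ j s → s < completion j → received j s < size j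

      totalFlowTime : Carrier
      totalFlowTime = sum (λ j → completion j - release j)

    -- B consists of the m members of Q with largest remaining processing time
    -- at time s, ties broken arbitrarily, or of all of Q if it has fewer.
    record IsLargest (s : Carrier) (Q : Subset (n I)) (m : ℕ)
                     (B : Subset (n I)) : Set where
      field
        subset  : B ⊆ Q
        card    : ∣ B ∣ ≡ m ℕ.⊓ ∣ Q ∣
        largest : ∀ i j → i ∈ B → j ∈ Q → j ∉ B →
                  remaining j s ≤ remaining i s

  open Completion using (totalFlowTime)

  IsOptimal : {I : Instance} → Schedule I → Set
  IsOptimal {I} S =
    ∃[ C ] (∀ (S′ : Schedule I) (C′ : Completion S′) →
            totalFlowTime {S = S} C ≤ totalFlowTime C′)

  module _ (ε : Carrier) {I : Instance} (S : Schedule I) where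
    open Instance I using (size)
    open Schedule S

    Known : Carrier → Pred (Fin (n I)) 0ℓ
    Known s j = Active S s j × remaining S j s ≤ ε * size j

    Unknown : Carrier → Pred (Fin (n I)) 0ℓ
    Unknown s j = Active S s j × ¬ (remaining S j s ≤ ε * size j)

    estimate : Fin (n I) → Carrier → Carrier
    estimate j s = if does (remaining S j s ≤? ε * size j)
                   then remaining S j s
                   else (ε * (1# - ε) ⁻¹) * received j s

    -- The minimum of the estimate over known jobs is at most the one over
    -- unknown jobs, where the minimum over the empty set is +∞ and at least
    -- one of the two sets is assumed nonempty.
    KnownFirst : Carrier → Set
    KnownFirst s =
      ∃[ k ] Known s k × (∀ j → Unknown s j → estimate k s ≤ estimate j s)

  -- In the second rule an empty set of active jobs yields an empty set of
  -- processed jobs.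
  record SLF (ε : Carrier) (I : Instance) : Set where
    field
      schedule : Schedule I
      touched  : Carrier → Subset (n I)

    open Schedule schedule

    field
      known-rule :
        ∀ s → 0# ≤ s → KnownFirst ε schedule s →
        ∃[ k ] Known ε schedule s k ×
               (∀ j → Known ε schedule s j →
                  estimate ε schedule k s ≤ estimate ε schedule j s) ×
               touched s ≡ ⁅ k ⁆

      unknown-rule :
        ∀ s → 0# ≤ s → ¬ KnownFirst ε schedule s →
        ∀ j → j ∈ touched s ⇔
              (Unknown ε schedule s j ×
               (∀ i → Unknown ε schedule s i →
                  estimate ε schedule j s ≤ estimate ε schedule i s))

      -- Following each time s, the processed set Q is constant for a while
      -- and each job in Q is processed at rate 1 / ∣ Q ∣.
      processing :
        ∀ s → 0# ≤ s →
        ∃[ δ ] 0# < δ × (∃[ Q ] (∀ u → s < u → u < s + δ →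
          touched u ≡ Q ×
          (∀ j → j ∈ Q → ∣ Q ∣ · (received j u - received j s) ≈ u - s) ×
          (∀ j → j ∉ Q → received j u ≈ received j s)))

  module _ {ε : Carrier} {I : Instance} (A : SLF ε I) where
    open SLF A
    open Schedule schedule

    U : Carrier → Pred (Fin (n I)) 0ℓ
    U = Unknown ε schedule

    -- Frozen jobs, relative to the horizon t.
    F : Carrier → Carrier → Pred (Fin (n I)) 0ℓ
    F t s j = U s j × (∀ u → s ≤ u → u ≤ t → j ∉ touched u)

    IsLeader : Carrier → Carrier → Fin (n I) → Set
    IsLeader t s L =
      (U s ∖ F t s) L ×
      (∀ j → (U s ∖ F t s) j → received j s ≤ received L s)

-- Fix κ = ε / (1 − ε), let e be the processing of the leader L at time t₁, and let
-- c = κ e be its estimate.  SLF processes L at t₁, so every active job has remaining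
-- time at least c then.  The largest estimate of a new unknown job never decreases
-- during (t₀ , t₁]: SLF prefers smaller estimates, so a job attaining the maximum is
-- processed only if all new unknown jobs attain it, and when such a job becomes known
-- another new unknown job of at least its estimate is still there.  For the same reason
-- a job can only drop to remaining time x while some new unknown job has an estimate of
-- at least x.  Hence a job of B(t₀) is either untouched during [t₀ , t₁] or had remaining
-- time at most c at t₀, and a job of size p released during [t₀ , t₁) satisfies
-- p ≤ e + r if it is unknown at t₁ with remaining time r, and ε p ≤ c otherwise.
--
-- Let θ ≥ c separate the remaining times of B(t₁) from those of the other active jobs.
-- Since e + θ ≤ ⌈1/ε⌉ θ, these facts give, job by job,
--   [j ∈ B(t₀)] (r_j(t₀) − θ) + [j new in OPT] (p_j − ⌈1/ε⌉ θ) ≤ [j ∈ B(t₁)] (r_j(t₁) − θ),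
-- and summing over all jobs yields the claim, because each new job of OPT adds ⌈1/ε⌉
-- elements to B(t₁).  If B(t₁) contains all active jobs, the claim follows since neither
-- schedule idles, so that both have the same total remaining volume.
module Submission where

open import Defs
open import Algebra.Bundles using (RawRing)
import Algebra.Solver.Ring
open import Algebra.Solver.Ring.AlmostCommutativeRing
  using (fromCommutativeRing; -raw-almostCommutative⟶; _-Raw-AlmostCommutative⟶_)
open import Data.Bool.Base using (true; false; if_then_else_)
open import Data.Fin.Base using (Fin; zero; suc)
open import Data.Fin.Properties using (any?; all?)
open import Data.Fin.Subset using (Subset; _∈_; _∉_; ∣_∣; _∩_; ∁)
open import Data.Fin.Subset.Properties
  using (_∈?_; x∈⁅y⁆⇒x≡y; x∈p∩q⁺; x∈p∩q⁻; x∈∁p⇒x∉p; x∉p⇒x∈∁p; p⊂q⇒∣p∣<∣q∣)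
open import Data.Maybe.Base as Maybe using (nothing)
open import Data.Nat.Base as ℕ using (ℕ; zero; suc) renaming (_*_ to _*ℕ_)
import Data.Nat.Properties as ℕ
open import Data.Product.Base using (∃; ∃-syntax; _×_; _,_; proj₁; proj₂)
open import Data.Product.Properties using (≡-dec)
open import Data.Sum.Base using (_⊎_; inj₁; inj₂)
open import Data.Vec.Base using (lookup; []; _∷_)
open import Data.Vec.Properties using ([]=⇒lookup; lookup⇒[]=; lookup∘tabulate)
open import Function.Base using (_∘_)
open import Function.Bundles using (Equivalence)
open import Level using (0ℓ)
open import Relation.Binary.Bundles using (DecTotalOrder)
open import Relation.Binary.Definitions using (_Respects_)
open import Relation.Binary.PropositionalEquality.Core as ≡ using (_≡_)
open import Relation.Nullary using (¬_; Dec; yes; no; does)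
open import Relation.Nullary.Decidable
  using (decidable-stable; dec⇒maybe; dec-true; dec-false; _×-dec_; _→-dec_; ¬?)
open import Relation.Nullary.Negation.Core using (contradiction)
open import Relation.Unary using (Pred; Decidable; _∖_; _≐_; Satisfiable) renaming (_∩_ to _∩ᵖ_)

-- Arithmetic and inequalities in an ordered field.

module RealProperties (ℝ : Reals) where
  open Reals ℝ hiding (zero)

  open import Algebra.Properties.Ring ring public using (-0#≈0#; -‿involutive; -‿distribˡ-*; -‿distribʳ-*)
  open import Algebra.Properties.AbelianGroup +-abelianGroup using (⁻¹-anti-homo‿-)
  open import Algebra.Properties.CommutativeMonoid.Sum +-commutativeMonoid public
    using (sum-cong-≋; ∑-distrib-+)
  open import Algebra.Properties.Semiring.Mult semiring public
    using (×-homo-+; ×-assocˡ; ×1-homo-*; ×-comm-*; ×-congʳ; ×-congˡ)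
  open DecTotalOrder decTotalOrder public
    using (_≟_; ≤-respˡ-≈; ≤-respʳ-≈)
    renaming (refl to ≤-refl; reflexive to ≤-reflexive; trans to ≤-trans; antisym to ≤-antisym;
              total to ≤-total)
  open import Relation.Binary.Properties.DecTotalOrder decTotalOrder public
    using (<-trans; <-irrefl; <-respˡ-≈; <-respʳ-≈; <⇒≱; ≰⇒>; ≮⇒≥)
  import Relation.Binary.Construct.NonStrictToStrict _≈_ _≤_ as ToStrict

  <-≤-trans : ∀ {x y z} → x < y → y ≤ z → x < z
  <-≤-trans = ToStrict.<-≤-trans sym ≤-trans ≤-antisym ≤-respʳ-≈

  ≤-<-trans : ∀ {x y z} → x ≤ y → y < z → x < z
  ≤-<-trans = ToStrict.≤-<-trans ≤-trans ≤-antisym ≤-respˡ-≈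

  -- Equality of reals does not compute, so the ring solver is run with integer
  -- coefficients, represented by formal differences (a , b) of naturals.
  module _ where
    private
      almostRing = fromCommutativeRing commutativeRing

      module S₀ = Algebra.Solver.Ring rawRing almostRing
                    (-raw-almostCommutative⟶ almostRing) (λ _ _ → nothing)

      cancel : ℕ → ℕ → ℕ × ℕ
      cancel (suc a) (suc b) = cancel a b
      cancel a       b       = a , b

      differences : RawRing 0ℓ 0ℓ
      differences = record
        { Carrier = ℕ × ℕ
        ; _≈_ = _≡_
        ; _+_ = λ (a , b) (c , d) → cancel (a ℕ.+ c) (b ℕ.+ d)
        ; _*_ = λ (a , b) (c , d) → cancel (a ℕ.* c ℕ.+ b ℕ.* d) (a ℕ.* d ℕ.+ b ℕ.* c)
        ; -_  = λ (a , b) → b , a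
        ; 0#  = 0 , 0
        ; 1#  = 1 , 0
        }

      ⟦_⟧ : ℕ × ℕ → Carrier
      ⟦ a , b ⟧ = a · 1# - b · 1#

      cancel-correct : ∀ a b → ⟦ cancel a b ⟧ ≈ a · 1# - b · 1#
      cancel-correct zero    b       = refl
      cancel-correct (suc a) zero    = refl
      cancel-correct (suc a) (suc b) = begin
        ⟦ cancel a b ⟧                          ≈⟨ cancel-correct a b ⟩
        a · 1# - b · 1#                         ≈⟨ +-identityʳ _ ⟨
        (a · 1# - b · 1#) + 0#                  ≈⟨ +-congˡ (-‿inverseʳ 1#) ⟨
        (a · 1# - b · 1#) + (1# - 1#)
          ≈⟨ S₀.solve 3 (λ a b o → (a S₀.:- b) S₀.:+ (o S₀.:- o) S₀.:= (o S₀.:+ a) S₀.:- (o S₀.:+ b))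
               refl (a · 1#) (b · 1#) 1# ⟩
        suc a · 1# - suc b · 1#                 ∎
        where
        open import Relation.Binary.Reasoning.Setoid setoid

      homo-*-+ : ∀ a b c d → (a ℕ.* c ℕ.+ b ℕ.* d) · 1# ≈
                 (a · 1#) * (c · 1#) + (b · 1#) * (d · 1#)
      homo-*-+ a b c d =
        trans (×-homo-+ 1# (a ℕ.* c) (b ℕ.* d)) (+-cong (×1-homo-* a c) (×1-homo-* b d))

      expand : ∀ a b c d → (a - b) * (c - d) ≈ (a * c + b * d) - (a * d + b * c)
      expand a b c d = begin
        (a - b) * (c - d)                                ≈⟨ distribˡ _ _ _ ⟩
        (a - b) * c + (a - b) * - d                      ≈⟨ +-cong (distribʳ _ _ _) (distribʳ _ _ _) ⟩
        (a * c + - b * c) + (a * - d + - b * - d)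
          ≈⟨ +-cong (+-congˡ (sym (-‿distribˡ-* _ _)))
               (+-cong (sym (-‿distribʳ-* _ _))
                  (trans (sym (-‿distribˡ-* _ _)) (trans (-‿cong (sym (-‿distribʳ-* _ _))) (-‿involutive _)))) ⟩
        (a * c - b * c) + (- (a * d) + b * d)
          ≈⟨ S₀.solve 4 (λ x y z w → (x S₀.:- y) S₀.:+ (S₀.:- z S₀.:+ w) S₀.:= (x S₀.:+ w) S₀.:- (z S₀.:+ y))
               refl (a * c) (b * c) (a * d) (b * d) ⟩
        (a * c + b * d) - (a * d + b * c)                ∎
        where
        open import Relation.Binary.Reasoning.Setoid setoid

      morphism : differences -Raw-AlmostCommutative⟶ almostRing
      morphism = record
        { ⟦_⟧ = ⟦_⟧
        ; +-homo = λ (a , b) (c , d) →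
            trans (cancel-correct (a ℕ.+ c) (b ℕ.+ d))
              (trans (+-cong (×-homo-+ 1# a c) (-‿cong (×-homo-+ 1# b d)))
                  (S₀.solve 4 (λ a b c d →
                     (a S₀.:+ c) S₀.:- (b S₀.:+ d) S₀.:= (a S₀.:- b) S₀.:+ (c S₀.:- d))
                   refl (a · 1#) (b · 1#) (c · 1#) (d · 1#)))
        ; *-homo = λ (a , b) (c , d) →
            trans (cancel-correct (a ℕ.* c ℕ.+ b ℕ.* d) (a ℕ.* d ℕ.+ b ℕ.* c))
              (trans (+-cong (homo-*-+ a b c d) (-‿cong (homo-*-+ a b d c)))
                     (sym (expand (a · 1#) (b · 1#) (c · 1#) (d · 1#))))
        ; -‿homo = λ (a , b) → sym (⁻¹-anti-homo‿- (a · 1#) (b · 1#))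
        ; 0-homo = -‿inverseʳ 0#
        ; 1-homo = trans (+-cong (+-identityʳ 1#) -0#≈0#) (+-identityʳ 1#)
        }

    open Algebra.Solver.Ring differences almostRing morphism
      (λ p q → Maybe.map (λ p≡q → reflexive (≡.cong ⟦_⟧ p≡q)) (dec⇒maybe (≡-dec ℕ._≟_ ℕ._≟_ p q)))
      public using (solve; _:=_; _:+_; _:*_; _:-_; :-_)

  private
    variable
      a b c d s u v x y z : Carrier
      P Q : Pred Carrier 0ℓ

  abstract
    ≤⇒0≤ : x ≤ y → 0# ≤ y - x
    ≤⇒0≤ {x} {y} x≤y =
      ≤-respˡ-≈ (-‿inverseˡ x) (≤-respʳ-≈ (+-comm (- x) y) (+-monoʳ-≤ (- x) x≤y))

    0≤⇒≤ : 0# ≤ y - x → x ≤ y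
    0≤⇒≤ {y} {x} 0≤ =
      ≤-respˡ-≈ (+-identityʳ x)
        (≤-respʳ-≈ (solve 2 (λ x y → x :+ (y :- x) := y) refl x y) (+-monoʳ-≤ x 0≤))

    +-mono-≤ : a ≤ b → c ≤ d → a + c ≤ b + d
    +-mono-≤ {a} {b} {c} {d} a≤b c≤d =
      ≤-trans (+-monoʳ-≤ a c≤d)
        (≤-respˡ-≈ (+-comm d a) (≤-respʳ-≈ (+-comm d b) (+-monoʳ-≤ d a≤b)))

    -- Linear arithmetic: x ≤ y follows from inequalities whose slacks sum to y − x.
    lin₁ : a ≤ b → b - a ≈ y - x → x ≤ y
    lin₁ a≤b eq = 0≤⇒≤ (≤-respʳ-≈ eq (≤⇒0≤ a≤b))

    lin₂ : a ≤ b → c ≤ d → (b - a) + (d - c) ≈ y - x → x ≤ y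
    lin₂ a≤b c≤d eq =
      0≤⇒≤ (≤-respʳ-≈ eq (≤-respˡ-≈ (+-identityʳ 0#) (+-mono-≤ (≤⇒0≤ a≤b) (≤⇒0≤ c≤d))))

    lin₃ : a ≤ b → c ≤ d → u ≤ v → (b - a) + (d - c) + (v - u) ≈ y - x → x ≤ y
    lin₃ a≤b c≤d u≤v eq =
      lin₂ (≤-respˡ-≈ (+-identityʳ 0#) (+-mono-≤ (≤⇒0≤ a≤b) (≤⇒0≤ c≤d))) u≤v
        (trans (+-congʳ (trans (+-congˡ -0#≈0#) (+-identityʳ _))) eq)

    -- The strict forms are proved by contradiction: negating the goal reverses the sign of its
    -- slack, and the nonstrict form then refutes `a < b`.
    lin<₁ : a < b → b - a ≈ y - x → x < y
    lin<₁ {a} {b} {y} {x} a<b eq = ≰⇒> λ y≤x →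
      <⇒≱ a<b (lin₁ y≤x (trans (solve 2 (λ x y → x :- y := :- (y :- x)) refl x y)
        (trans (-‿cong (sym eq)) (solve 2 (λ a b → :- (b :- a) := a :- b) refl a b))))

    lin<₂ : a < b → c ≤ d → (b - a) + (d - c) ≈ y - x → x < y
    lin<₂ {a} {b} {c} {d} {y} {x} a<b c≤d eq = ≰⇒> λ y≤x → <⇒≱ a<b
      (lin₂ y≤x c≤d (trans (+-congʳ (trans
        (solve 2 (λ x y → x :- y := :- (y :- x)) refl x y) (-‿cong (sym eq))))
        (solve 4 (λ a b c d → :- ((b :- a) :+ (d :- c)) :+ (d :- c) := a :- b) refl a b c d)))

    *-monoʳ-≤ : 0# ≤ z → x ≤ y → z * x ≤ z * y
    *-monoʳ-≤ {z} {x} {y} 0≤z x≤y = 0≤⇒≤ (≤-respʳ-≈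
      (solve 3 (λ x y z → z :* (y :- x) := z :* y :- z :* x) refl x y z)
      (*-nonneg 0≤z (≤⇒0≤ x≤y)))

    *-cancelˡ-≈ : ¬ z ≈ 0# → z * x ≈ z * y → x ≈ y
    *-cancelˡ-≈ {z} {x} {y} z≉0 eq = trans (sym (undo x)) (trans (*-congˡ eq) (undo y))
      where
      undo : ∀ x → z ⁻¹ * (z * x) ≈ x
      undo x = trans (sym (*-assoc _ _ _))
        (trans (*-congʳ (trans (*-comm _ _) (⁻¹-inverseʳ z≉0))) (*-identityˡ x))

    *-monoʳ-< : 0# < z → x < y → z * x < z * y
    *-monoʳ-< (0≤z , 0≉z) (x≤y , x≉y) =
      *-monoʳ-≤ 0≤z x≤y , x≉y ∘ *-cancelˡ-≈ (0≉z ∘ sym)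

    *-cancelˡ-≤ : 0# < z → z * x ≤ z * y → x ≤ y
    *-cancelˡ-≤ 0<z zx≤zy = ≮⇒≥ λ y<x → <⇒≱ (*-monoʳ-< 0<z y<x) zx≤zy

    *-cancelˡ-< : 0# ≤ z → z * x < z * y → x < y
    *-cancelˡ-< 0≤z zx<zy = ≰⇒> λ y≤x → <⇒≱ zx<zy (*-monoʳ-≤ 0≤z y≤x)

    0<1 : 0# < 1#
    0<1 with ≤-total 0# 1#
    ... | inj₁ 0≤1 = 0≤1 , 0≉1
    -- If `1# ≤ 0#`, then `- 1#` is nonnegative, and so is its square `1#`.
    ... | inj₂ 1≤0 = contradiction (≤-antisym 0≤1 1≤0) 0≉1
      where
      0≤-1 : 0# ≤ - 1#
      0≤-1 = ≤-respʳ-≈ (+-identityˡ (- 1#)) (≤⇒0≤ 1≤0)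
      0≤1 : 0# ≤ 1#
      0≤1 = ≤-respʳ-≈ (trans (solve 1 (λ o → :- o :* :- o := o :* o) refl 1#) (*-identityʳ 1#))
              (*-nonneg 0≤-1 0≤-1)

    0<⁻¹ : 0# < x → 0# < x ⁻¹
    0<⁻¹ {x} 0<x = *-cancelˡ-< (proj₁ 0<x)
      (<-respˡ-≈ (sym (zeroʳ x)) (<-respʳ-≈ (sym (⁻¹-inverseʳ (proj₂ 0<x ∘ sym))) 0<1))

    <-dense : x < y → ∃[ m ] x < m × m < y
    <-dense {x} {y} x<y = m ,
        -- The midpoint `m` enters only through `m + m ≈ x + y`: a violated bound, used twice, gives
        -- `y ≤ x`.
        ≰⇒> (λ m≤x → <⇒≱ x<y (lin₂ m≤x m≤x
          (trans (solve 3 (λ x y m → (x :- m) :+ (x :- m) := (x :+ x) :- (m :+ m)) refl x y m)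
            (trans (+-congˡ (-‿cong m+m)) (solve 2 (λ x y → (x :+ x) :- (x :+ y) := x :- y) refl x y))))) ,
        ≰⇒> (λ y≤m → <⇒≱ x<y (lin₂ y≤m y≤m
          (trans (solve 2 (λ y m → (m :- y) :+ (m :- y) := (m :+ m) :- (y :+ y)) refl y m)
            (trans (+-congʳ m+m) (solve 2 (λ x y → (x :+ y) :- (y :+ y) := x :- y) refl x y)))))
      where
      h m : Carrier
      h = (1# + 1#) ⁻¹
      m = h * (x + y)
      0<2 : 0# < 1# + 1#
      0<2 = <-≤-trans 0<1 (≤-respˡ-≈ (+-identityʳ 1#) (+-monoʳ-≤ 1# (proj₁ 0<1)))
      h+h : h + h ≈ 1#
      h+h = trans (sym (trans (distribʳ h 1# 1#) (+-cong (*-identityˡ h) (*-identityˡ h))))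
              (⁻¹-inverseʳ (proj₂ 0<2 ∘ sym))
      m+m : m + m ≈ x + y
      m+m = trans (sym (distribʳ (x + y) h h)) (trans (*-congʳ h+h) (*-identityˡ (x + y)))

    x-0≈x : ∀ x → x - 0# ≈ x
    x-0≈x x = trans (+-congˡ -0#≈0#) (+-identityʳ x)

    <⇒0< : x < y → 0# < y - x
    <⇒0< x<y = lin<₁ x<y (sym (x-0≈x _))

    *-pos : 0# < x → 0# < y → 0# < x * y
    *-pos 0<x 0<y = <-respˡ-≈ (zeroʳ _) (*-monoʳ-< 0<x 0<y)

    [1-x]y≈y-xy : ∀ x y → (1# - x) * y ≈ y - x * y
    [1-x]y≈y-xy x y = trans (distribʳ y 1# (- x)) (+-cong (*-identityˡ y) (sym (-‿distribˡ-* x y)))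

    x<x+y : 0# < y → x < x + y
    x<x+y {y} {x} 0<y =
      lin<₁ 0<y (trans (x-0≈x y) (solve 2 (λ x y → y := (x :+ y) :- x) refl x y))

    x≤y⇒x-y≤0 : x ≤ y → x - y ≤ 0#
    x≤y⇒x-y≤0 {x} {y} x≤y =
      lin₁ x≤y (trans (solve 2 (λ x y → y :- x := :- (x :- y)) refl x y) (sym (+-identityˡ _)))

  -- One-sided punctured neighbourhoods and real induction.

  JustAfter JustBefore : Carrier → Pred Carrier 0ℓ → Set
  JustAfter  s P = ∃[ v ] s < v × (∀ u → s < u → u < v → P u)
  JustBefore s P = ∃[ v ] v < s × (∀ u → v < u → u < s → P u)

  infixr 5 _∩ᵃ_ _∩ᵇ_

  abstract
    always-after : (∀ u → s < u → P u) → JustAfter s P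
    always-after {s} h = s + 1# , x<x+y 0<1 , λ u s<u _ → h u s<u

    below-after : s < x → JustAfter s (_< x)
    below-after {x = x} s<x = x , s<x , λ _ _ u<x → u<x

    above-before : x < s → JustBefore s (x <_)
    above-before {x} x<s = x , x<s , λ _ x<u _ → x<u

    after-map : (∀ u → s < u → P u → Q u) → JustAfter s P → JustAfter s Q
    after-map f (v , s<v , h) = v , s<v , λ u s<u u<v → f u s<u (h u s<u u<v)

    _∩ᵃ_ : JustAfter s P → JustAfter s Q → JustAfter s (P ∩ᵖ Q)
    (v , s<v , f) ∩ᵃ (w , s<w , g) with ≤-total v w
    ... | inj₁ v≤w = v , s<v , λ u s<u u<v → f u s<u u<v , g u s<u (<-≤-trans u<v v≤w)
    ... | inj₂ w≤v = w , s<w , λ u s<u u<w → f u s<u (<-≤-trans u<w w≤v) , g u s<u u<w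

    _∩ᵇ_ : JustBefore s P → JustBefore s Q → JustBefore s (P ∩ᵖ Q)
    (v , v<s , f) ∩ᵇ (w , w<s , g) with ≤-total v w
    ... | inj₁ v≤w = w , w<s , λ u w<u u<s → f u (≤-<-trans v≤w w<u) u<s , g u w<u u<s
    ... | inj₂ w≤v = v , v<s , λ u v<u u<s → f u v<u u<s , g u (≤-<-trans w≤v v<u) u<s

    after-∀ : ∀ {n} {P : Fin n → Pred Carrier 0ℓ} →
              (∀ j → JustAfter s (P j)) → JustAfter s (λ u → ∀ j → P j u)
    after-∀ {n = zero}  h = always-after λ _ _ ()
    after-∀ {n = suc n} h =
      after-map (λ { u _ (p , q) zero → p ; u _ (p , q) (suc j) → q j }) (h zero ∩ᵃ after-∀ (h ∘ suc))

    after-initial : JustAfter s P → JustAfter s (λ u → ∀ w → s < w → w < u → P w)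
    after-initial (v , s<v , h) = v , s<v , λ u _ u<v w s<w w<u → h w s<w (<-trans w<u u<v)

    after-point : JustAfter s P → ∃[ u ] s < u × P u
    after-point (v , s<v , h) = let u , s<u , u<v = <-dense s<v in u , s<u , h u s<u u<v

    before-point : JustBefore s P → ∃[ u ] u < s × P u
    before-point (v , v<s , h) = let u , v<u , u<s = <-dense v<s in u , u<s , h u v<u u<s

  -- Let `σ` be the supremum of the points up to which `P` holds throughout. Then `before` gives
  -- `P σ`, and if `σ < y`, `after` would carry `P` beyond `σ`. Decidability turns the indirect
  -- information from the supremum into proofs of `P`.
  real-induction :
    Decidable P → P Respects _≈_ → x ≤ y → P x →
    (∀ s → x ≤ s → s < y → P s → JustAfter s (λ u → u ≤ y → P u)) →
    (∀ s → x < s → s ≤ y → (∀ u → x ≤ u → u < s → P u) → P s) →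
    P y
  real-induction {P} {x} {y} P? resp x≤y Px after before = P-y
    where
    S : Pred Carrier 0ℓ
    S z = x ≤ z × z ≤ y × (∀ u → x ≤ u → u ≤ z → P u)

    x∈S : S x
    x∈S = ≤-refl , x≤y , λ u x≤u u≤x → resp (≤-antisym x≤u u≤x) Px

    bound : ∃[ b ] (∀ z → S z → z ≤ b)
    bound = y , λ _ → proj₁ ∘ proj₂
    sup = supremum S (x , x∈S) bound
    σ = proj₁ sup
    σ-upper = proj₁ (proj₂ sup)
    σ-least = proj₂ (proj₂ sup)

    x≤σ : x ≤ σ
    x≤σ = σ-upper x x∈S

    σ≤y : σ ≤ y
    σ≤y = σ-least y (λ _ → proj₁ ∘ proj₂)

    -- If `P u` failed, no member of `S` could exceed `u`, so `u` would be an upper bound below `σ`.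
    P-below : ∀ u → x ≤ u → u < σ → P u
    P-below u x≤u u<σ = decidable-stable (P? u) λ ¬Pu → <⇒≱ u<σ
      (σ-least u λ z (_ , _ , h) → ≮⇒≥ λ u<z → ¬Pu (h u x≤u (proj₁ u<z)))

    P-σ : P σ
    P-σ with x ≟ σ
    ... | yes x≈σ = resp x≈σ Px
    ... | no  x≉σ = before σ (x≤σ , x≉σ) σ≤y P-below

    P-y : P y
    P-y with σ ≟ y
    ... | yes σ≈y = resp σ≈y P-σ
    ... | no  σ≉y
      with u , σ<u , (h , Pu) , u<y ←
             after-point ((after-initial (after σ x≤σ (σ≤y , σ≉y) P-σ) ∩ᵃ after σ x≤σ (σ≤y , σ≉y) P-σ)
                          ∩ᵃ below-after (σ≤y , σ≉y))
      = contradiction (σ-upper u (≤-trans x≤σ (proj₁ σ<u) , proj₁ u<y , P-upto)) (<⇒≱ σ<u)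
      where
      P-upto : ∀ w → x ≤ w → w ≤ u → P w
      P-upto w x≤w w≤u with w ≤? σ
      ... | no w≰σ with w ≟ u
      ...   | yes w≈u = resp (sym w≈u) (Pu (proj₁ u<y))
      ...   | no  w≉u = h w (≰⇒> w≰σ) (w≤u , w≉u) (≤-trans w≤u (proj₁ u<y))
      P-upto w x≤w w≤u | yes w≤σ with w ≟ σ
      ...   | yes w≈σ = resp (sym w≈σ) P-σ
      ...   | no  w≉σ = P-below w x≤w (w≤σ , w≉σ)

  -- Finite sums, sums over subsets, and maxima.

  sum-mono : ∀ {n} {f g : Fin n → Carrier} → (∀ j → f j ≤ g j) → sum f ≤ sum g
  sum-mono {zero}  h = ≤-refl
  sum-mono {suc n} h = +-mono-≤ (h zero) (sum-mono (h ∘ suc))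

  sum-nonneg : ∀ {n} {f : Fin n → Carrier} → (∀ j → 0# ≤ f j) → 0# ≤ sum f
  sum-nonneg {zero}  h = ≤-refl
  sum-nonneg {suc n} h = ≤-respˡ-≈ (+-identityʳ 0#) (+-mono-≤ (h zero) (sum-nonneg (h ∘ suc)))

  term≤sum : ∀ {n} {f : Fin n → Carrier} → (∀ j → 0# ≤ f j) → ∀ j → f j ≤ sum f
  term≤sum h zero    = ≤-respˡ-≈ (+-identityʳ _) (+-monoʳ-≤ _ (sum-nonneg (h ∘ suc)))
  term≤sum h (suc j) = ≤-respˡ-≈ (+-identityˡ _) (+-mono-≤ (h zero) (term≤sum (h ∘ suc) j))

  sum-sub : ∀ {n} (f g : Fin n → Carrier) → sum (λ j → f j - g j) ≈ sum f - sum g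
  sum-sub {zero}  f g = sym (-‿inverseʳ 0#)
  sum-sub {suc n} f g = trans (+-congˡ (sum-sub (f ∘ suc) (g ∘ suc)))
    (solve 4 (λ a b x y → (a :- b) :+ (x :- y) := (a :+ x) :- (b :+ y))
      refl (f zero) (g zero) (sum (f ∘ suc)) (sum (g ∘ suc)))

  ·-nonneg : ∀ n → 0# ≤ x → 0# ≤ n · x
  ·-nonneg zero    0≤x = ≤-refl
  ·-nonneg (suc n) 0≤x = ≤-respˡ-≈ (+-identityʳ 0#) (+-mono-≤ 0≤x (·-nonneg n 0≤x))

  ·-monoˡ-≤ : ∀ {m n} → 0# ≤ x → m ℕ.≤ n → m · x ≤ n · x
  ·-monoˡ-≤ {n = n} 0≤x ℕ.z≤n = ·-nonneg n 0≤x
  ·-monoˡ-≤ 0≤x (ℕ.s≤s m≤n) = +-monoʳ-≤ _ (·-monoˡ-≤ 0≤x m≤n)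

  ·-monoʳ-≤ : ∀ n → x ≤ y → n · x ≤ n · y
  ·-monoʳ-≤ zero    x≤y = ≤-refl
  ·-monoʳ-≤ (suc n) x≤y = +-mono-≤ x≤y (·-monoʳ-≤ n x≤y)

  module _ {n : ℕ} where
    -- Has the shape of the summand in `volume`, so that `volume` is by definition a sum of
    -- `restrict`.
    restrict : Subset n → (Fin n → Carrier) → Fin n → Carrier
    restrict Q f j = if lookup Q j then f j else 0#

    restrict-∈ : ∀ {Q f j} → j ∈ Q → restrict Q f j ≡ f j
    restrict-∈ {f = f} {j} j∈Q = ≡.cong (λ b → if b then f j else 0#) ([]=⇒lookup j∈Q)

    restrict-∉ : ∀ {Q f j} → j ∉ Q → restrict Q f j ≡ 0#
    restrict-∉ {Q} {f} {j} j∉Q with lookup Q j in eq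
    ... | true  = contradiction (lookup⇒[]= j Q eq) j∉Q
    ... | false = ≡.refl

    restrict-nonneg : ∀ Q {f} j → (j ∈ Q → 0# ≤ f j) → 0# ≤ restrict Q f j
    restrict-nonneg Q {f} j h with j ∈? Q
    ... | yes j∈Q = ≤-respʳ-≈ (reflexive (≡.sym (restrict-∈ {f = f} j∈Q))) (h j∈Q)
    ... | no  j∉Q = ≤-reflexive (reflexive (≡.sym (restrict-∉ {f = f} j∉Q)))

    sum-restrict-mono : ∀ Q {f g} → (∀ j → j ∈ Q → f j ≤ g j) → sum (restrict Q f) ≤ sum (restrict Q g)
    sum-restrict-mono Q {f} {g} h = sum-mono pointwise
      where
      pointwise : ∀ j → restrict Q f j ≤ restrict Q g j
      pointwise j with lookup Q j in eq
      ... | true  = h j (lookup⇒[]= j Q eq)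
      ... | false = ≤-refl

    sum-restrict-sub : ∀ Q f g → sum (restrict Q (λ j → f j - g j)) ≈ sum (restrict Q f) - sum (restrict Q g)
    sum-restrict-sub Q f g = trans (sum-cong-≋ pointwise) (sum-sub (restrict Q f) (restrict Q g))
      where
      pointwise : ∀ j → restrict Q (λ j → f j - g j) j ≈ restrict Q f j - restrict Q g j
      pointwise j with lookup Q j
      ... | true  = refl
      ... | false = sym (-‿inverseʳ 0#)

  sum-restrict-const : ∀ {n} (Q : Subset n) x → sum (restrict Q (λ _ → x)) ≈ ∣ Q ∣ · x
  sum-restrict-const []          x = refl
  sum-restrict-const (true  ∷ Q) x = +-congˡ (sum-restrict-const Q x)
  sum-restrict-const (false ∷ Q) x = trans (+-identityˡ _) (sum-restrict-const Q x)

  -- The floor `c` serves as the maximum when no index satisfies `P`; the last component says that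
  -- the result is the least upper bound of `c` and the selected values.
  maximum : ∀ {n} {P : Pred (Fin n) 0ℓ} → Decidable P → (f : Fin n → Carrier) → ∀ c →
            ∃[ m ] c ≤ m × (∀ j → P j → f j ≤ m) × (∀ b → c ≤ b → (∀ j → P j → f j ≤ b) → m ≤ b)
  maximum {zero}  P? f c = c , ≤-refl , (λ ()) , λ b c≤b _ → c≤b
  maximum {suc n} P? f c
    with m , c≤m , upper , least ← maximum (P? ∘ suc) (f ∘ suc) c
    with P? zero
  ... | no ¬P0 = m , c≤m ,
        (λ { zero P0 → contradiction P0 ¬P0 ; (suc j) Pj → upper j Pj }) ,
        λ b c≤b h → least b c≤b (h ∘ suc)
  ... | yes P0 with ≤-total (f zero) m
  ...   | inj₁ f0≤m = m , c≤m ,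
          (λ { zero _ → f0≤m ; (suc j) Pj → upper j Pj }) ,
          λ b c≤b h → least b c≤b (h ∘ suc)
  ...   | inj₂ m≤f0 = f zero , ≤-trans c≤m m≤f0 ,
          (λ { zero _ → ≤-refl ; (suc j) Pj → ≤-trans (upper j Pj) m≤f0 }) ,
          λ b c≤b h → h zero P0

does-true : ∀ {A : Set} (a? : Dec A) → does a? ≡ true → A
does-true (yes a) _ = a

module SchedulingProperties (ℝ : Reals) where
  open Reals ℝ hiding (zero)
  open RealProperties ℝ
  open Scheduling ℝ

  -- General schedules: monotonicity and continuity of processing.

  module ScheduleProperties {I : Instance} (S : Schedule I) where
    open Instance I
    open Schedule S

    private
      variable
        j : Fin n
        s t x : Carrier

    rem : Fin n → Carrier → Carrier
    rem = remaining S

    abstract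
      received-nonneg : ∀ j s → 0# ≤ received j s
      received-nonneg j s with ≤-total s (release j)
      ... | inj₁ s≤r = ≤-reflexive (sym (before-release j s s≤r))
      ... | inj₂ r≤s = ≤-respˡ-≈ (before-release j (release j) ≤-refl) (monotone j r≤s)

      received-cong : s ≈ t → received j s ≈ received j t
      received-cong s≈t = ≤-antisym (monotone _ (≤-reflexive s≈t)) (monotone _ (≤-reflexive (sym s≈t)))

      -- The increment of one job is among the nonnegative summands that unit speed bounds in total.
      received-lipschitz : s ≤ t → received j t - received j s ≤ t - s
      received-lipschitz {j = j} s≤t =
        ≤-trans (term≤sum (λ i → ≤⇒0≤ (monotone i s≤t)) j) (unit-speed s≤t)

      remaining-cong : received j s ≈ received j t → rem j s ≈ rem j t
      remaining-cong eq = +-congˡ (-‿cong eq)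

      remaining-antitone : s ≤ t → rem j t ≤ rem j s
      remaining-antitone {s} {t} {j} s≤t = lin₁ (monotone j s≤t)
        (solve 3 (λ p a b → b :- a := (p :- a) :- (p :- b)) refl (size j) (received j s) (received j t))

      remaining-nonneg : ∀ j s → 0# ≤ rem j s
      remaining-nonneg j s = ≤⇒0≤ (bounded j s)

      remaining≤size : ∀ j s → rem j s ≤ size j
      remaining≤size j s = lin₁ (received-nonneg j s)
        (trans (x-0≈x _) (solve 2 (λ p a → a := p :- (p :- a)) refl (size j) (received j s)))

      remaining-unreleased : s ≤ release j → rem j s ≈ size j
      remaining-unreleased s≤r =
        trans (+-congˡ (-‿cong (before-release _ _ s≤r))) (x-0≈x _)

      -- Left continuity: since rates are at most 1, going back by less than the gap
      -- `received j s - x` cannot use it up. `remaining-after` is the counterpart to the right.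
      received-before : x < received j s → JustBefore s (λ u → x < received j u)
      received-before {x} {j} {s} x<e = s - (received j s - x) ,
        lin<₁ x<e (solve 3 (λ s e x → e :- x := s :- (s :- (e :- x))) refl s (received j s) x) ,
        λ u v<u u<s → lin<₂ v<u (received-lipschitz (proj₁ u<s))
          (solve 5 (λ s u e f x → (u :- (s :- (e :- x))) :+ ((s :- u) :- (e :- f)) := f :- x) refl
            s u (received j s) (received j u) x)

      remaining-after : x < rem j s → JustAfter s (λ u → x < rem j u)
      remaining-after {x} {j} {s} x<r = s + (rem j s - x) ,
        lin<₁ x<r (solve 3 (λ s r x → r :- x := (s :+ (r :- x)) :- s) refl s (rem j s) x) ,
        λ u s<u u<v → lin<₂ u<v (received-lipschitz (proj₁ s<u))
          (solve 6 (λ s u e f p x → ((s :+ ((p :- e) :- x)) :- u) :+ ((u :- s) :- (f :- e)) := (p :- f) :- x) refl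
            s u (received j s) (received j u) (size j) x)

      ∈-activeSet⁺ : Active S s j → j ∈ activeSet S s
      ∈-activeSet⁺ {s} {j} a =
        lookup⇒[]= j _ (≡.trans (lookup∘tabulate _ j) (dec-true (active? S s j) a))

      ∈-activeSet⁻ : j ∈ activeSet S s → Active S s j
      ∈-activeSet⁻ {j} {s} j∈ =
        does-true (active? S s j) (≡.trans (≡.sym (lookup∘tabulate _ j)) ([]=⇒lookup j∈))

  -- Consequences of the SLF rules.

  module SLFProperties {ε : Carrier} (0<ε : 0# < ε) (ε<1 : ε < 1#)
                       {I : Instance} (A : SLF ε I) where
    open Instance I
    open SLF A
    open Schedule schedule
    open ScheduleProperties schedule public

    private
      variable
        i j k L : Fin n
        s t x y : Carrier

    κ : Carrier
    κ = ε * (1# - ε) ⁻¹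

    abstract
      0<1-ε : 0# < 1# - ε
      0<1-ε = <⇒0< ε<1

      0<κ : 0# < κ
      0<κ = *-pos 0<ε (0<⁻¹ 0<1-ε)

      -- Multiplying by `1# - ε` clears the inverse in `κ`; comparisons with estimates are carried
      -- out in this form.
      [1-ε]κx≈εx : ∀ x → (1# - ε) * (κ * x) ≈ ε * x
      [1-ε]κx≈εx x = trans
        (solve 4 (λ d e i x → d :* ((e :* i) :* x) := (d :* i) :* (e :* x)) refl (1# - ε) ε ((1# - ε) ⁻¹) x)
        (trans (*-congʳ (⁻¹-inverseʳ (proj₂ 0<1-ε ∘ sym))) (*-identityˡ _))

      κ-mono : x ≤ y → κ * x ≤ κ * y
      κ-mono = *-monoʳ-≤ (proj₁ 0<κ)

      κ-cancel-≤ : κ * x ≤ κ * y → x ≤ y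
      κ-cancel-≤ = *-cancelˡ-≤ 0<κ

      κ-cancel-< : κ * x < κ * y → x < y
      κ-cancel-< = *-cancelˡ-< (proj₁ 0<κ)

      -- With p = e + r, the hypothesis reads ε (e + r) < r, that is, ε e < (1 - ε) r.
      unknown⇒κ*received<remaining : ε * size j < rem j s → κ * received j s < rem j s
      unknown⇒κ*received<remaining {j} {s} h = *-cancelˡ-< (proj₁ 0<1-ε)
        (<-respˡ-≈ (sym ([1-ε]κx≈εx _)) (<-respʳ-≈ (sym ([1-x]y≈y-xy ε (rem j s)))
          (lin<₁ h (solve 3 (λ p e ε → (p :- e) :- ε :* p := ((p :- e) :- ε :* (p :- e)) :- ε :* e) refl
            (size j) (received j s) ε))))

      -- Here x ≤ ε p = ε (r + e) ≤ ε x + ε e, that is, (1 - ε) x ≤ ε e.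
      remaining≤⇒≤κ*received : rem j s ≤ x → x ≤ ε * size j → x ≤ κ * received j s
      remaining≤⇒≤κ*received {j} {s} {x} r≤x x≤εp = *-cancelˡ-≤ 0<1-ε
        (≤-respʳ-≈ (sym ([1-ε]κx≈εx _)) (≤-respˡ-≈ (sym ([1-x]y≈y-xy ε x))
          (lin₂ x≤εp (*-monoʳ-≤ (proj₁ 0<ε) r≤x)
            (solve 4 (λ p e ε x → (ε :* p :- x) :+ (ε :* x :- ε :* (p :- e)) := ε :* e :- (x :- ε :* x)) refl
              (size j) (received j s) ε x))))

    Kn Un : Carrier → Pred (Fin n) 0ℓ
    Kn = Known ε schedule
    Un = Unknown ε schedule

    known? : ∀ s → Decidable (Kn s)
    known? s j = active? schedule s j ×-dec (rem j s ≤? ε * size j)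

    unknown? : ∀ s → Decidable (Un s)
    unknown? s j = active? schedule s j ×-dec ¬? (rem j s ≤? ε * size j)

    η : Fin n → Carrier → Carrier
    η = estimate ε schedule

    estimate-known : Kn s j → η j s ≡ rem j s
    estimate-known {s} {j} (_ , r≤) =
      ≡.cong (λ b → if b then rem j s else κ * received j s) (dec-true (rem j s ≤? ε * size j) r≤)

    estimate-unknown : Un s j → η j s ≡ κ * received j s
    estimate-unknown {s} {j} (_ , r≰) =
      ≡.cong (λ b → if b then rem j s else κ * received j s) (dec-false (rem j s ≤? ε * size j) r≰)

    knownFirst? : ∀ s → Dec (KnownFirst ε schedule s)
    knownFirst? s = any? λ k → known? s k ×-dec all? λ j → unknown? s j →-dec (η k s ≤? η j s)

    abstract
      touched⇒known⊎unknown : 0# ≤ s → j ∈ touched s → Kn s j ⊎ Un s j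
      touched⇒known⊎unknown {s} {j} 0≤s j∈ with knownFirst? s
      ... | no ¬kf = inj₂ (proj₁ (Equivalence.to (unknown-rule s 0≤s ¬kf j) j∈))
      ... | yes kf with k , Kk , _ , touched≡k ← known-rule s 0≤s kf
                   with ≡.refl ← x∈⁅y⁆⇒x≡y k (≡.subst (j ∈_) touched≡k j∈) = inj₁ Kk

      -- Known jobs are touched only under the first rule. There `j` has the least known estimate,
      -- and the witness of `KnownFirst` is already below every unknown estimate.
      touched-known : 0# ≤ s → j ∈ touched s → Kn s j → Un s i → rem j s ≤ κ * received i s
      touched-known {s} {j} {i} 0≤s j∈ Kj Ui with knownFirst? s
      ... | no ¬kf = contradiction (proj₂ Kj)
                       (proj₂ (proj₁ (Equivalence.to (unknown-rule s 0≤s ¬kf j) j∈)))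
      ... | yes kf@(k′ , Kk′ , k′-least) with k , Kk , k-least , touched≡k ← known-rule s 0≤s kf
                   with ≡.refl ← x∈⁅y⁆⇒x≡y k (≡.subst (j ∈_) touched≡k j∈) =
        ≡.subst₂ _≤_ (estimate-known Kj) (estimate-unknown Ui) (≤-trans (k-least k′ Kk′) (k′-least i Ui))

      touched-unknown⇒¬KnownFirst : 0# ≤ s → j ∈ touched s → Un s j → ¬ KnownFirst ε schedule s
      touched-unknown⇒¬KnownFirst {s} {j} 0≤s j∈ Uj kf
        with k , Kk , _ , touched≡k ← known-rule s 0≤s kf
        with ≡.refl ← x∈⁅y⁆⇒x≡y k (≡.subst (j ∈_) touched≡k j∈) = proj₂ Uj (proj₂ Kk)

      touched-unknown : 0# ≤ s → j ∈ touched s → Un s j → Un s i → received j s ≤ received i s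
      touched-unknown {s} {j} {i} 0≤s j∈ Uj Ui = κ-cancel-≤
        (≡.subst₂ _≤_ (estimate-unknown Uj) (estimate-unknown Ui)
          (proj₂ (Equivalence.to (unknown-rule s 0≤s (touched-unknown⇒¬KnownFirst 0≤s j∈ Uj) j) j∈) i Ui))

      -- Otherwise `k` would witness `KnownFirst`, because the estimate of `j` is minimal among the
      -- unknown jobs, and the first rule touches no unknown job.
      touched-unknown<known : 0# ≤ s → j ∈ touched s → Un s j → Kn s k → κ * received j s < rem k s
      touched-unknown<known {s} {j} {k} 0≤s j∈ Uj Kk = ≰⇒> λ rk≤κej →
        touched-unknown⇒¬KnownFirst 0≤s j∈ Uj (k , Kk , λ i Ui →
          ≡.subst₂ _≤_ (≡.sym (estimate-known Kk)) (≡.sym (estimate-unknown Ui))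
            (≤-trans rk≤κej (κ-mono (touched-unknown 0≤s j∈ Uj Ui))))

      -- That i is untouched may be shown assuming that it has not been processed so far.
      received-const : 0# ≤ s → s ≤ t →
        (∀ v → s ≤ v → v < t → received i v ≈ received i s → JustAfter v (λ w → w < t → i ∉ touched w)) →
        received i t ≈ received i s
      received-const {s} {t} {i} 0≤s s≤t untouched = real-induction
        (λ v → received i v ≟ received i s) (λ u≈v eq → trans (received-cong (sym u≈v)) eq) s≤t refl after before
        where
        after : ∀ v → s ≤ v → v < t → received i v ≈ received i s →
                JustAfter v (λ u → u ≤ t → received i u ≈ received i s)
        after v s≤v v<t eq with δ , 0<δ , Q , h ← processing v (≤-trans 0≤s s≤v) with i ∈? Q
        ... | no  i∉Q = v + δ , x<x+y 0<δ , λ u v<u u<v+δ _ → trans (proj₂ (proj₂ (h u v<u u<v+δ)) i i∉Q) eq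
        -- A job of `Q` is touched at all times just after `v`, against the hypothesis at one such
        -- time `w`.
        ... | yes i∈Q =
          let w , v<w , w<v+δ , w<t , i∉ = after-point
                (below-after (x<x+y 0<δ) ∩ᵃ below-after v<t ∩ᵃ untouched v s≤v v<t eq)
          in contradiction (≡.subst (i ∈_) (≡.sym (proj₁ (h w v<w w<v+δ))) i∈Q) (i∉ w<t)

        before : ∀ v → s < v → v ≤ t → (∀ u → s ≤ u → u < v → received i u ≈ received i s) →
                 received i v ≈ received i s
        before v s<v v≤t h = ≤-antisym (≮⇒≥ λ es<ev →
          let u , u<v , s<u , es<eu = before-point (above-before s<v ∩ᵇ received-before es<ev)
          in <-irrefl (sym (h u (proj₁ s<u) u<v)) es<eu) (monotone i (proj₁ s<v))

      unknown-later : Un s j → s ≤ t → ε * size j < rem j t → Un t j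
      unknown-later {s} {j} ((r<s , _) , _) s≤t h =
        (<-≤-trans r<s s≤t , ≤-<-trans (*-nonneg (proj₁ 0<ε) (proj₁ (size>0 j))) h) , <⇒≱ h

      unknown-earlier : Un t j → release j < s → s ≤ t → Un s j
      unknown-earlier ((_ , 0<r) , r≰) r<s s≤t =
        (r<s , <-≤-trans 0<r (remaining-antitone s≤t)) , λ r≤ → r≰ (≤-trans (remaining-antitone s≤t) r≤)

      unknown-const : Un s j → s ≤ t → received j t ≈ received j s → Un t j
      unknown-const Uj s≤t eq = unknown-later Uj s≤t (<-respʳ-≈ (remaining-cong (sym eq)) (≰⇒> (proj₂ Uj)))

      -- SLF prefers the unknown job k to i throughout, whether i is known or unknown.
      overtaken : 0# ≤ s → s ≤ t → release k < s → Un t k →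
                  κ * received k t < rem i s → received k t < received i s →
                  received i t ≈ received i s
      overtaken {s} {t} {k} {i} 0≤s s≤t rk<s Uk y<r y<e = received-const 0≤s s≤t λ v s≤v v<t eq →
        -- While `i` has received nothing since `s`, its remaining time stays above the estimate of
        -- `k` for a while by continuity.
        after-map (λ w v<w y<r′ w<t i∈ → untouched w (≤-trans s≤v (proj₁ v<w)) (proj₁ w<t) y<r′ i∈)
          (remaining-after (<-respʳ-≈ (remaining-cong (sym eq)) y<r))
        where
        untouched : ∀ w → s ≤ w → w ≤ t → κ * received k t < rem i w → i ∉ touched w
        untouched w s≤w w≤t y<r′ i∈ with touched⇒known⊎unknown (≤-trans 0≤s s≤w) i∈
        ... | inj₁ Ki = <⇒≱ y<r′
              (≤-trans (touched-known (≤-trans 0≤s s≤w) i∈ Ki Uk-w) (κ-mono (monotone k w≤t)))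
          where
          Uk-w : Un w k
          Uk-w = unknown-earlier Uk (<-≤-trans rk<s s≤w) w≤t
        ... | inj₂ Ui = <⇒≱ y<e (≤-trans (monotone i s≤w)
              (≤-trans (touched-unknown (≤-trans 0≤s s≤w) i∈ Ui Uk-w) (monotone k w≤t)))
          where
          Uk-w : Un w k
          Uk-w = unknown-earlier Uk (<-≤-trans rk<s s≤w) w≤t

    -- Monotonicity of the largest estimate of a new unknown job.

    module NewUnknown (t₀ t₁ : Carrier) (0≤t₀ : 0# ≤ t₀)
                      (new-exists : ∀ s → t₀ < s → s ≤ t₁ → ∃ (Un s ∖ Un t₀)) where

      -- Expresses that the largest estimate of a new unknown job is at least `x`. With the
      -- threshold fixed, growth of the maximum becomes preservation of a decidable property, to
      -- which real induction applies.
      Reached : Carrier → Carrier → Set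
      Reached x s = ∃[ j ] (Un s ∖ Un t₀) j × x ≤ κ * received j s

      reached? : ∀ x → Decidable (Reached x)
      reached? x s = any? λ j → (unknown? s j ×-dec ¬? (unknown? t₀ j)) ×-dec (x ≤? κ * received j s)

      abstract
        reached-const : (Un s ∖ Un t₀) j → x ≤ κ * received j s →
                        s ≤ t → received j t ≈ received j s → Reached x t
        reached-const {j = j} (Uj , new) x≤ s≤t eq =
          j , (unknown-const Uj s≤t eq , new) , ≤-trans x≤ (κ-mono (monotone j s≤t))

        reached-cong : Reached x Respects _≈_
        reached-cong s≈t (j , Uj , x≤) = reached-const Uj x≤ (≤-reflexive s≈t) (received-cong (sym s≈t))

        -- A witness stays unknown for a while by continuity. At a left limit `v`, where it may
        -- become known, `new-exists` supplies a replacement `k`; if the estimate of `k` is below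
        -- `x`, the old witness was not processed just before `v` and thus survives.
        reached-mono : t₀ ≤ s → s ≤ t → t ≤ t₁ → Reached x s → Reached x t
        reached-mono {s} {t} {x} t₀≤s s≤t t≤t₁ reached =
          real-induction (reached? x) reached-cong s≤t reached after before
          where
          after : ∀ v → s ≤ v → v < t → Reached x v → JustAfter v (λ u → u ≤ t → Reached x u)
          after v _ _ (j , (Uj , new) , x≤) = after-map
            (λ u v<u h _ → j , (unknown-later Uj (proj₁ v<u) h , new) ,
              ≤-trans x≤ (κ-mono (monotone j (proj₁ v<u))))
            (remaining-after (≰⇒> (proj₂ Uj)))

          before : ∀ v → s < v → v ≤ t → (∀ u → s ≤ u → u < v → Reached x u) → Reached x v
          before v s<v v≤t h with k , Uk ← new-exists v (≤-<-trans t₀≤s s<v) (≤-trans v≤t t≤t₁)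
                             with x ≤? κ * received k v
          ... | yes x≤ = k , Uk , x≤
          ... | no  x≰ =
            -- `u` is close enough to `v` for `k` to be released. The job `i` has a larger estimate
            -- at `u` than `k` has at `v`, so SLF does not process it in between.
            let u , u<v , s<u , rk<u = before-point (above-before s<v ∩ᵇ above-before (proj₁ (proj₁ (proj₁ Uk))))
                i , Ui , x≤ = h u (proj₁ s<u) u<v
                y<e = <-≤-trans (≰⇒> x≰) x≤
            in reached-const Ui x≤ (proj₁ u<v)
                 (overtaken (≤-trans 0≤t₀ (≤-trans t₀≤s (proj₁ s<u))) (proj₁ u<v) rk<u (proj₁ Uk)
                   (<-trans y<e (unknown⇒κ*received<remaining (≰⇒> (proj₂ (proj₁ Ui)))))
                   (κ-cancel-< y<e))

        -- The invariant is that `rem i s ≤ x` implies `Reached x s`, vacuous at `t₀`. If every new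
        -- unknown job had an estimate below `x` when the remaining time of `i` drops to `x`, SLF
        -- would prefer such a job to `i` just before, so `i` could not drop.
        remaining≤⇒reached : x ≤ ε * size i → x < rem i t₀ → t₀ ≤ t₁ → rem i t₁ ≤ x → Reached x t₁
        remaining≤⇒reached {x} {i} x≤εp x<r₀ t₀≤t₁ = real-induction
          (λ s → (rem i s ≤? x) →-dec reached? x s)
          (λ s≈t h r≤x → reached-cong s≈t (h (≤-respˡ-≈ (remaining-cong (received-cong (sym s≈t))) r≤x)))
          t₀≤t₁ (λ r₀≤x → contradiction r₀≤x (<⇒≱ x<r₀)) after before
          where
          P : Carrier → Set
          P s = rem i s ≤ x → Reached x s

          after : ∀ v → t₀ ≤ v → v < t₁ → P v → JustAfter v (λ u → u ≤ t₁ → P u)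
          after v t₀≤v _ h with rem i v ≤? x
          ... | yes r≤x = always-after λ u v<u u≤t₁ _ → reached-mono t₀≤v (proj₁ v<u) u≤t₁ (h r≤x)
          ... | no  r≰x = after-map (λ u _ x<r _ r≤x → contradiction r≤x (<⇒≱ x<r)) (remaining-after (≰⇒> r≰x))

          before : ∀ v → t₀ < v → v ≤ t₁ → (∀ u → t₀ ≤ u → u < v → P u) → P v
          before v t₀<v v≤t₁ h r≤x with k , Uk ← new-exists v t₀<v v≤t₁ with x ≤? κ * received k v
          ... | yes x≤ = k , Uk , x≤
          ... | no  x≰ =
            let u , u<v , t₀<u , rk<u , y<e = before-point (above-before t₀<v ∩ᵇ
                   above-before (proj₁ (proj₁ (proj₁ Uk))) ∩ᵇ received-before (κ-cancel-< y<κe))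
            in reached-at u (proj₁ t₀<u) u<v rk<u y<e
            where
            -- `overtaken` also covers times at which `i` is still unknown, for which `i` must have
            -- received more than `k`; `x ≤ ε * size i` yields this.
            y<κe : κ * received k v < κ * received i v
            y<κe = <-≤-trans (≰⇒> x≰) (remaining≤⇒≤κ*received r≤x x≤εp)

            reached-at : ∀ u → t₀ ≤ u → u < v → release k < u → received k v < received i u → Reached x v
            reached-at u t₀≤u u<v rk<u y<e with rem i u ≤? x
            ... | yes r≤x′ = reached-mono t₀≤u (proj₁ u<v) v≤t₁ (h u t₀≤u u<v r≤x′)
            ... | no  r≰x′ = contradiction (≤-respˡ-≈ (remaining-cong stuck) r≤x) r≰x′
              where
              stuck : received i v ≈ received i u
              stuck = overtaken (≤-trans 0≤t₀ t₀≤u) (proj₁ u<v) rk<u (proj₁ Uk)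
                        (<-trans (≰⇒> x≰) (≰⇒> r≰x′)) y<e

module Transfer (ℝ : Reals) where
  open Reals ℝ hiding (zero)
  open RealProperties ℝ
  open Scheduling ℝ
  open SchedulingProperties ℝ

  -- Volumes of non-idling schedules and the sets of largest jobs.

  module _ {I : Instance} where
    open Instance I
    open Schedule using (received)

    abstract
      -- Real induction on `u ≤ Σ u`. If `O` has an unfinished released job at `v`, it runs at full
      -- speed just after. Otherwise, just after `v`, every job is finished in `O` or unreleased, so
      -- `O` is ahead of `S` job by job, and `S` has processed `u` in total.
      nonidling-volume : (S O : Schedule I) → ∀ {s t} →
        NoIdlingUntil S t → NoUnnecessaryIdling O → 0# ≤ s → s ≤ t → s ≤ sum (λ j → received O j s)
      nonidling-volume S O {s} {t} busyS busyO 0≤s s≤t = real-induction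
        (λ u → u ≤? sum (λ j → received O j u))
        (λ u≈v u≤Σ → ≤-respˡ-≈ u≈v (≤-trans u≤Σ (sum-mono λ j → Schedule.monotone O j (≤-reflexive u≈v))))
        0≤s (sum-nonneg λ j → O.received-nonneg j 0#) after before
        where
        module S = ScheduleProperties S
        module O = ScheduleProperties O

        Σ : Carrier → Carrier
        Σ u = sum (λ j → received O j u)

        before : ∀ v → 0# < v → v ≤ s → (∀ u → 0# ≤ u → u < v → u ≤ Σ u) → v ≤ Σ v
        before v 0<v _ h = ≮⇒≥ λ Σ<v →
          let u , u<v , 0<u , Σ<u = before-point (above-before 0<v ∩ᵇ above-before Σ<v)
          in <⇒≱ Σ<u (≤-trans (h u (proj₁ 0<u) u<v) (sum-mono λ j → Schedule.monotone O j (proj₁ u<v)))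

        after : ∀ v → 0# ≤ v → v < s → v ≤ Σ v → JustAfter v (λ u → u ≤ s → u ≤ Σ u)
        -- The test is `release j ≤ v`, since a job released exactly at `v` is active from
        -- immediately after `v`.
        after v 0≤v _ v≤Σv with any? (λ j → (release j ≤? v) ×-dec (0# <? O.rem j v))
        ... | yes (j , rj≤v , 0<r) = after-map
              (λ u v<u h _ → lin₂ v≤Σv
                (≤-reflexive (sym (trans (sym (sum-sub (λ i → received O i u) (λ i → received O i v)))
                  (busyO 0≤v (proj₁ v<u) λ w v<w w<u → j , ≤-<-trans rj≤v v<w , h w v<w w<u))))
                (solve 4 (λ u v x y → (y :- v) :+ ((x :- y) :- (u :- v)) := x :- u) refl u v (Σ u) (Σ v)))
              (after-initial (O.remaining-after 0<r))
        ... | no none = after-map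
              (λ u v<u h u≤s → ≤-respˡ-≈ (busyS u (≤-trans 0≤v (proj₁ v<u)) (≤-trans u≤s s≤t)) (sum-mono h))
              (after-∀ behind)
          where
          behind : ∀ j → JustAfter v (λ u → received S j u ≤ received O j u)
          behind j with release j ≤? v
          ... | yes rj≤v = always-after λ u v<u →
                ≤-trans (Schedule.bounded S j u) (≤-trans
                  (lin₁ (≮⇒≥ λ 0<r → none (j , rj≤v , 0<r))
                    (solve 3 (λ p e z → z :- (p :- e) := (z :+ e) :- p) refl (size j) (received O j v) 0#))
                  (≤-trans (≤-reflexive (+-identityˡ _)) (Schedule.monotone O j (proj₁ v<u))))
          ... | no  rj≰v = after-map
                (λ u _ u<r → ≤-respˡ-≈ (sym (Schedule.before-release S j u (proj₁ u<r))) (O.received-nonneg j u))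
                (below-after (≰⇒> rj≰v))

      -- Both schedules have processed the same total volume, and every job released
      -- but not in B is finished in S.
      volume-all-active : (S O : Schedule I) → ∀ {s t} →
        NoIdlingUntil S t → NoUnnecessaryIdling O → 0# ≤ s → s ≤ t →
        (B Q : Subset n) → (∀ j → Active S s j → j ∈ B) →
        (∀ j → j ∈ Q → Active O s j) → volume O Q s ≤ volume S B s
      volume-all-active S O {s} {t} busyS busyO 0≤s s≤t B Q ⊆B Q⊆ =
        -- `S` has processed exactly `s` and `O` at least `s`, so the balance `total` leaves the
        -- claim.
        lin₃ total (≤-reflexive (busyS s 0≤s s≤t)) (nonidling-volume S O busyS busyO 0≤s s≤t)
          (solve 5 (λ s x y v w → (((w :+ x) :- (v :+ y)) :+ (s :- x)) :+ (y :- s) := w :- v) refl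
             s (sum (λ j → received S j s)) (sum (λ j → received O j s)) (volume O Q s) (volume S B s))
        where
        module S = ScheduleProperties S
        module O = ScheduleProperties O

        r rO : Fin n → Carrier
        r  j = S.rem j s
        rO j = O.rem j s

        size-left : ∀ p e → (p - e) + e ≈ p
        size-left = solve 2 (λ p e → (p :- e) :+ e := p) refl

        lower : ∀ j → restrict Q rO j + received O j s ≤ size j
        lower j with j ∈? Q
        ... | yes j∈Q = ≤-reflexive (trans (+-congʳ (reflexive (restrict-∈ {f = rO} j∈Q))) (size-left _ _))
        ... | no  j∉Q = ≤-respˡ-≈ (sym (trans (+-congʳ (reflexive (restrict-∉ {f = rO} j∉Q))) (+-identityˡ _)))
                          (Schedule.bounded O j s)

        upper : ∀ j → release j < s → size j ≤ restrict B r j + received S j s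
        upper j rj<s with j ∈? B
        ... | yes j∈B = ≤-reflexive (sym (trans (+-congʳ (reflexive (restrict-∈ {f = r} j∈B))) (size-left _ _)))
        ... | no  j∉B = lin₁ (≮⇒≥ λ 0<r → j∉B (⊆B j (rj<s , 0<r)))
          (trans (solve 3 (λ p e z → z :- (p :- e) := (z :+ e) :- p) refl (size j) (received S j s) 0#)
            (+-congʳ (+-congʳ (sym (reflexive (restrict-∉ {f = r} j∉B))))))

        pointwise : ∀ j → restrict Q rO j + received O j s ≤ restrict B r j + received S j s
        pointwise j with release j <? s
        ... | yes rj<s = ≤-trans (lower j) (upper j rj<s)
        ... | no  rj≮s = +-mono-≤
          (≤-respˡ-≈ (sym (reflexive (restrict-∉ {f = rO} (rj≮s ∘ proj₁ ∘ Q⊆ j))))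
            (restrict-nonneg B {f = r} j λ _ → S.remaining-nonneg j s))
          (≤-respˡ-≈ (sym (Schedule.before-release O j s (≮⇒≥ rj≮s))) (S.received-nonneg j s))

        total : volume O Q s + sum (λ j → received O j s) ≤ volume S B s + sum (λ j → received S j s)
        total = ≤-respˡ-≈ (∑-distrib-+ (restrict Q rO) (λ j → received O j s))
          (≤-respʳ-≈ (∑-distrib-+ (restrict B r) (λ j → received S j s)) (sum-mono pointwise))

      -- `θ` is the largest remaining time left out of `B`, or `c` if nothing is left out; as `c`
      -- bounds all of `Q` from below, `θ` stays below the members of `B` in both cases.
      largest-threshold : (S : Schedule I) → ∀ {s Q m B c} → IsLargest S s Q m B →
        (∀ j → j ∈ Q → c ≤ remaining S j s) →
        ∃[ θ ] c ≤ θ × (∀ j → j ∈ B → θ ≤ remaining S j s) × (∀ j → j ∈ Q → j ∉ B → remaining S j s ≤ θ)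
      largest-threshold S {s} {Q} {B = B} {c} isLargest c≤ =
        let θ , c≤θ , upper , least = maximum (λ j → (j ∈? Q) ×-dec ¬? (j ∈? B)) (λ j → remaining S j s) c
        in θ , c≤θ ,
           (λ i i∈B → least _ (c≤ i (subset i∈B)) λ j (j∈Q , j∉B) → largest i j i∈B j∈Q j∉B) ,
           (λ j j∈Q j∉B → upper j (j∈Q , j∉B))
        where
        open IsLargest isLargest

      largest-all : (S : Schedule I) → ∀ {s Q m B} → IsLargest S s Q m B →
                    ∣ Q ∣ ℕ.≤ m → ∀ {j} → j ∈ Q → j ∈ B
      largest-all S {Q = Q} {m} {B} isLargest ∣Q∣≤m {j} j∈Q = decidable-stable (j ∈? B) λ j∉B →
        ℕ.<-irrefl (≡.trans card (ℕ.m≥n⇒m⊓n≡n ∣Q∣≤m)) (p⊂q⇒∣p∣<∣q∣ (subset , j , j∈Q , j∉B))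
        where
        open IsLargest isLargest

  -- How the jobs of both schedules evolve between `t₀` and `t₁`.

  module _
    (ε : Carrier) (0<ε : 0# < ε) (ε<1 : ε < 1#)
    (k : ℕ) (ceiling : IsCeiling (ε ⁻¹) k)
    {I : Instance} (A : SLF ε I) (opt : Schedule I)
    {t : Carrier}
    (busy-slf : NoIdlingUntil (SLF.schedule A) t) (busy-opt : NoUnnecessaryIdling opt)
    (B : Carrier → Subset (Instance.n I))
    (B-largest : ∀ s → 0# ≤ s → s ≤ t →
      IsLargest (SLF.schedule A) s (activeSet (SLF.schedule A) s) (k *ℕ ∣ activeAtBoth opt t s ∣) (B s))
    {t₀ t₁ : Carrier} (0≤t₀ : 0# ≤ t₀) (t₀≤t₁ : t₀ ≤ t₁) (t₁≤t : t₁ ≤ t)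
    (U≐F : U A t₀ ≐ F A t t₀)
    {L : Fin (Instance.n I)} (leader : IsLeader A t t₁ L) (L-touched : L ∈ SLF.touched A t₁)
    (F-const : F A t t₀ ≐ F A t t₁)
    (new-exists : ∀ s → t₀ < s → s ≤ t₁ → Satisfiable (U A s ∖ U A t₀))
    where

    open Instance I
    open SLF A using (touched) renaming (schedule to slf)
    open Schedule slf
    open SLFProperties 0<ε ε<1 A
    open NewUnknown t₀ t₁ 0≤t₀ new-exists
    module O = ScheduleProperties opt

    private
      variable
        j : Fin n
        x y θ : Carrier

    0≤t₁ : 0# ≤ t₁
    0≤t₁ = ≤-trans 0≤t₀ t₀≤t₁

    c : Carrier
    c = κ * received L t₁

    O₀ O₁ N : Subset n
    O₀ = activeAtBoth opt t t₀
    O₁ = activeAtBoth opt t t₁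
    N  = O₁ ∩ ∁ O₀

    rO : Carrier → Fin n → Carrier
    rO s j = remaining opt j s

    abstract
      -- From `k` ≥ 1/ε follows 1 ≤ ε `k`, hence x ≤ `k` (ε x).
      capacity : 0# ≤ x → ε * x ≤ θ → x ≤ k · θ
      capacity {x} {θ} 0≤x εx≤θ = ≤-trans
        (≤-respˡ-≈ (*-identityʳ x) (≤-respʳ-≈ eq (*-monoʳ-≤ 0≤x 1≤εk)))
        (·-monoʳ-≤ k εx≤θ)
        where
        1≤εk : 1# ≤ ε * (k · 1#)
        1≤εk = ≤-respˡ-≈ (⁻¹-inverseʳ (proj₂ 0<ε ∘ sym)) (*-monoʳ-≤ (proj₁ 0<ε) (proj₁ ceiling))
        eq : x * (ε * (k · 1#)) ≈ k · (ε * x)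
        eq = trans (solve 3 (λ x e o → x :* (e :* o) := (e :* x) :* o) refl x ε (k · 1#))
               (trans (×-comm-* k (ε * x) 1#) (×-congʳ k (*-identityʳ (ε * x))))

      -- κ y ≤ θ means ε y ≤ (1 - ε) θ, that is, ε (y + θ) ≤ θ, and `capacity` applies.
      capacity-κ : 0# ≤ y → 0# ≤ θ → κ * y ≤ θ → y + θ ≤ k · θ
      capacity-κ {y} {θ} 0≤y 0≤θ κy≤θ = capacity
        (≤-respˡ-≈ (+-identityʳ 0#) (+-mono-≤ 0≤y 0≤θ))
        (lin₁ (≤-respˡ-≈ ([1-ε]κx≈εx y) (≤-respʳ-≈ ([1-x]y≈y-xy ε θ) (*-monoʳ-≤ (proj₁ 0<1-ε) κy≤θ)))
          (solve 3 (λ e y θ → (θ :- e :* θ) :- e :* y := θ :- e :* (y :+ θ)) refl ε y θ))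

      0≤c : 0# ≤ c
      0≤c = *-nonneg (proj₁ 0<κ) (received-nonneg L t₁)

      L-unknown : Un t₁ L
      L-unknown = proj₁ (proj₁ leader)

      -- A job frozen at `t₁` is frozen at `t₀` and so unknown there. Hence a new unknown job is not
      -- frozen, and the leader dominates it.
      new-received≤ : Un t₁ j → ¬ Un t₀ j → received j t₁ ≤ received L t₁
      new-received≤ {j} Uj new = proj₂ leader j (Uj , λ Fj → new (proj₂ U≐F (proj₂ F-const Fj)))

      reached⇒≤c : Reached x t₁ → x ≤ c
      reached⇒≤c (j , (Uj , new) , x≤) = ≤-trans x≤ (κ-mono (new-received≤ Uj new))

      active⇒c≤remaining : Active slf t₁ j → c ≤ rem j t₁
      active⇒c≤remaining {j} act with rem j t₁ ≤? ε * size j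
      ... | yes r≤ = proj₁ (touched-unknown<known 0≤t₁ L-touched L-unknown (act , r≤))
      ... | no  r≰ = ≤-trans (κ-mono (touched-unknown 0≤t₁ L-touched L-unknown (act , r≰)))
                       (proj₁ (unknown⇒κ*received<remaining (≰⇒> r≰)))

      -- An unknown job at `t₀` is frozen. A known one that was processed passes every level between
      -- its two remaining times, and `remaining≤⇒reached` makes each such level at most `c`.
      old-job : Active slf t₀ j → received j t₁ ≈ received j t₀ ⊎ rem j t₀ ≤ c
      old-job {j} act with rem j t₀ ≤? ε * size j
      ... | no r≰ = inj₁ (received-const 0≤t₀ t₀≤t₁ λ v t₀≤v _ _ → always-after λ w v<w w<t₁ →
              proj₂ (proj₁ U≐F (act , r≰)) w (≤-trans t₀≤v (proj₁ v<w)) (≤-trans (proj₁ w<t₁) t₁≤t))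
      ... | yes r≤ with received j t₁ ≟ received j t₀ | rem j t₀ ≤? c
      ...   | yes e≈ | _       = inj₁ e≈
      ...   | no  _  | yes r≤c = inj₂ r≤c
      ...   | no  e≉ | no  r≰c =
        -- `x` lies strictly between the larger of `c` and `rem j t₁` and the value `rem j t₀`.
        let x , x<r₀ , c<x , r₁<x = before-point (above-before (≰⇒> r≰c) ∩ᵇ above-before r₁<r₀)
        in contradiction
             (reached⇒≤c (remaining≤⇒reached (≤-trans (proj₁ x<r₀) r≤) x<r₀ t₀≤t₁ (proj₁ r₁<x)))
             (<⇒≱ c<x)
        where
        r₁<r₀ : rem j t₁ < rem j t₀
        r₁<r₀ = lin<₁ (monotone j t₀≤t₁ , e≉ ∘ sym)
          (solve 3 (λ p e f → f :- e := (p :- e) :- (p :- f)) refl (size j) (received j t₀) (received j t₁))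

      N⇒O₁ : j ∈ N → j ∈ O₁
      N⇒O₁ = proj₁ ∘ x∈p∩q⁻ O₁ (∁ O₀)

      N⇒∉O₀ : j ∈ N → j ∉ O₀
      N⇒∉O₀ = x∈∁p⇒x∉p ∘ proj₂ ∘ x∈p∩q⁻ O₁ (∁ O₀)

      O₁⇒active : j ∈ O₁ → Active opt t j × Active opt t₁ j
      O₁⇒active j∈O₁ = let a , b = x∈p∩q⁻ (activeSet opt t) (activeSet opt t₁) j∈O₁
                       in O.∈-activeSet⁻ a , O.∈-activeSet⁻ b

      O₀⇒active : j ∈ O₀ → Active opt t j × Active opt t₀ j
      O₀⇒active j∈O₀ = let a , b = x∈p∩q⁻ (activeSet opt t) (activeSet opt t₀) j∈O₀
                       in O.∈-activeSet⁻ a , O.∈-activeSet⁻ b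

      O₀⇒O₁ : j ∈ O₀ → j ∈ O₁
      O₀⇒O₁ j∈O₀ = let (rj<t , 0<r) , (rj<t₀ , _) = O₀⇒active j∈O₀
        in x∈p∩q⁺ (O.∈-activeSet⁺ (rj<t , 0<r) ,
                   O.∈-activeSet⁺ (<-≤-trans rj<t₀ t₀≤t₁ , <-≤-trans 0<r (O.remaining-antitone t₁≤t)))

      -- OPT has not finished `j` at `t₁`, hence not at `t₀` either, so only a later release can
      -- keep it out of `O₀`.
      N⇒released : j ∈ N → t₀ ≤ release j × release j < t₁
      N⇒released {j} j∈N = let actₜ , (rj<t₁ , 0<r) = O₁⇒active (N⇒O₁ j∈N)
        in ≮⇒≥ (λ rj<t₀ → N⇒∉O₀ j∈N (x∈p∩q⁺ (O.∈-activeSet⁺ actₜ ,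
             O.∈-activeSet⁺ (rj<t₀ , <-≤-trans 0<r (O.remaining-antitone t₀≤t₁))))) , rj<t₁

      -- `O₁` is the disjoint union of `O₀` and `N`, as jobs unfinished at `t` never leave OPT's
      -- active set before.
      sum-O₁ : ∀ f → sum (restrict O₁ f) ≈ sum (restrict O₀ f) + sum (restrict N f)
      sum-O₁ f = trans (sum-cong-≋ pointwise) (∑-distrib-+ (restrict O₀ f) (restrict N f))
        where
        pointwise : ∀ j → restrict O₁ f j ≈ restrict O₀ f j + restrict N f j
        pointwise j with j ∈? O₀ | j ∈? O₁
        ... | yes j∈O₀ | _ = trans (reflexive (restrict-∈ {f = f} (O₀⇒O₁ j∈O₀)))
              (sym (trans (+-cong (reflexive (restrict-∈ {f = f} j∈O₀))
                (reflexive (restrict-∉ {f = f} λ j∈N → N⇒∉O₀ j∈N j∈O₀))) (+-identityʳ _)))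
        ... | no j∉O₀ | yes j∈O₁ = trans (reflexive (restrict-∈ {f = f} j∈O₁))
              (sym (trans (+-cong (reflexive (restrict-∉ {f = f} j∉O₀))
                (reflexive (restrict-∈ {f = f} (x∈p∩q⁺ (j∈O₁ , x∉p⇒x∈∁p j∉O₀))))) (+-identityˡ _)))
        ... | no j∉O₀ | no j∉O₁ = trans (reflexive (restrict-∉ {f = f} j∉O₁))
              (sym (trans (+-cong (reflexive (restrict-∉ {f = f} j∉O₀))
                (reflexive (restrict-∉ {f = f} (j∉O₁ ∘ N⇒O₁)))) (+-identityˡ _)))

      ∣O₁∣· : ∀ x → ∣ O₁ ∣ · x ≈ ∣ O₀ ∣ · x + ∣ N ∣ · x
      ∣O₁∣· x = trans (sym (sum-restrict-const O₁ x)) (trans (sum-O₁ (λ _ → x))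
        (+-cong (sum-restrict-const O₀ x) (sum-restrict-const N x)))

      opt-growth : volume opt O₁ t₁ ≤ volume opt O₀ t₀ + sum (restrict N size)
      opt-growth = ≤-respˡ-≈ (sym (sum-O₁ (rO t₁)))
        (+-mono-≤ (sum-restrict-mono O₀ λ j _ → O.remaining-antitone t₀≤t₁)
                  (sum-restrict-mono N λ j _ → O.remaining≤size j t₁))

    private
      B₀ B₁ : Subset n
      B₀ = B t₀
      B₁ = B t₁

    -- The inequality per job relative to a threshold, and its sum.

    module _ {θ : Carrier} (c≤θ : c ≤ θ)
             (θ≤B₁ : ∀ j → j ∈ B₁ → θ ≤ rem j t₁)
             (∉B₁≤θ : ∀ j → j ∈ activeSet slf t₁ → j ∉ B₁ → rem j t₁ ≤ θ) where

      -- Subtracting `θ` makes jobs outside `B₁` count at most zero; a new job of OPT pays `k · θ`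
      -- for the `k` elements it adds to `B₁`.
      gain₀ gainN gain₁ : Fin n → Carrier
      gain₀ j = rem j t₀ - θ
      gainN j = size j - k · θ
      gain₁ j = rem j t₁ - θ

      abstract
        0≤gain₁ : ∀ j → 0# ≤ restrict B₁ gain₁ j
        0≤gain₁ j = restrict-nonneg B₁ {f = gain₁} j λ j∈B → ≤⇒0≤ (θ≤B₁ j j∈B)

        active-gain : Active slf t₁ j → gain₁ j ≤ restrict B₁ gain₁ j
        active-gain {j} act with j ∈? B₁
        ... | yes j∈B = ≤-reflexive (reflexive (≡.sym (restrict-∈ {f = gain₁} j∈B)))
        ... | no  j∉B = ≤-trans (x≤y⇒x-y≤0 (∉B₁≤θ j (∈-activeSet⁺ act) j∉B)) (0≤gain₁ j)

        B₀-active : j ∈ B₀ → Active slf t₀ j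
        B₀-active j∈B = ∈-activeSet⁻ (IsLargest.subset (B-largest t₀ 0≤t₀ (≤-trans t₀≤t₁ t₁≤t)) j∈B)

        old-gain : j ∈ B₀ → gain₀ j ≤ restrict B₁ gain₁ j
        old-gain {j} j∈B₀ with act@(rj<t₀ , 0<r) ← B₀-active j∈B₀ with old-job act
        ... | inj₁ e≈ = ≤-respˡ-≈ (+-congʳ (remaining-cong e≈)) (active-gain
              (<-≤-trans rj<t₀ t₀≤t₁ , <-respʳ-≈ (remaining-cong (sym e≈)) 0<r))
        ... | inj₂ r≤c = ≤-trans (x≤y⇒x-y≤0 (≤-trans r≤c c≤θ)) (0≤gain₁ j)

        -- If `j` is unknown at `t₁`, its size is at most the leader's processing plus `rem j t₁`,
        -- and `capacity-κ` absorbs the former. Otherwise its remaining time dropped to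
        -- `ε * size j`, so this level is at most `c` and `capacity` makes the gain nonpositive.
        new-gain : j ∈ N → gainN j ≤ restrict B₁ gain₁ j
        new-gain {j} j∈N with t₀≤rj , rj<t₁ ← N⇒released j∈N with unknown? t₁ j
        ... | yes Uj = ≤-trans
              (lin₂ (capacity-κ (received-nonneg L t₁) (≤-trans 0≤c c≤θ) c≤θ)
                    (new-received≤ Uj (<⇒≱-release ∘ proj₁ ∘ proj₁))
                (solve 5 (λ p e l θ kθ → (kθ :- (l :+ θ)) :+ (l :- e) := ((p :- e) :- θ) :- (p :- kθ)) refl
                  (size j) (received j t₁) (received L t₁) θ (k · θ)))
              (active-gain (proj₁ Uj))
          where
          <⇒≱-release : ¬ release j < t₀
          <⇒≱-release rj<t₀ = <⇒≱ rj<t₀ t₀≤rj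
        ... | no ¬Uj = ≤-trans (x≤y⇒x-y≤0 (capacity (proj₁ (size>0 j)) (≤-trans εp≤c c≤θ))) (0≤gain₁ j)
          where
          r₁≤εp : rem j t₁ ≤ ε * size j
          r₁≤εp = decidable-stable (rem j t₁ ≤? ε * size j) λ r≰ →
            ¬Uj ((rj<t₁ , ≤-<-trans (*-nonneg (proj₁ 0<ε) (proj₁ (size>0 j))) (≰⇒> r≰)) , r≰)
          εp<r₀ : ε * size j < rem j t₀
          εp<r₀ = <-respʳ-≈ (sym (remaining-unreleased t₀≤rj))
            (<-respʳ-≈ (*-identityʳ (size j))
              (<-respˡ-≈ (*-comm (size j) ε) (*-monoʳ-< (size>0 j) ε<1)))
          εp≤c : ε * size j ≤ c
          εp≤c = reached⇒≤c (remaining≤⇒reached ≤-refl εp<r₀ t₀≤t₁ r₁≤εp)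

        gain : ∀ j → restrict B₀ gain₀ j + restrict N gainN j ≤ restrict B₁ gain₁ j
        gain j with j ∈? B₀ | j ∈? N
        -- Members of `B₀` are released strictly before `t₀`, those of `N` are not.
        ... | yes j∈B₀ | yes j∈N = contradiction (proj₁ (N⇒released j∈N)) (<⇒≱ (proj₁ (B₀-active j∈B₀)))
        ... | yes j∈B₀ | no  j∉N = ≤-respˡ-≈ (sym (trans (+-cong (reflexive (restrict-∈ {f = gain₀} j∈B₀))
              (reflexive (restrict-∉ {f = gainN} j∉N))) (+-identityʳ _))) (old-gain j∈B₀)
        ... | no  j∉B₀ | yes j∈N = ≤-respˡ-≈ (sym (trans (+-cong (reflexive (restrict-∉ {f = gain₀} j∉B₀))
              (reflexive (restrict-∈ {f = gainN} j∈N))) (+-identityˡ _))) (new-gain j∈N)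
        ... | no  j∉B₀ | no  j∉N = ≤-respˡ-≈ (sym (trans (+-cong (reflexive (restrict-∉ {f = gain₀} j∉B₀))
              (reflexive (restrict-∉ {f = gainN} j∉N))) (+-identityʳ _))) (0≤gain₁ j)

        sum-gain : (volume slf B₀ t₀ - ∣ B₀ ∣ · θ) + (sum (restrict N size) - ∣ N ∣ · (k · θ)) ≤
                   volume slf B₁ t₁ - ∣ B₁ ∣ · θ
        sum-gain = ≤-respˡ-≈ (trans (∑-distrib-+ (restrict B₀ gain₀) (restrict N gainN))
            (+-cong (split B₀ (λ j → rem j t₀) θ) (split N size (k · θ))))
          (≤-respʳ-≈ (split B₁ (λ j → rem j t₁) θ) (sum-mono gain))
          where
          split : ∀ (Q : Subset n) f x → sum (restrict Q (λ j → f j - x)) ≈ sum (restrict Q f) - ∣ Q ∣ · x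
          split Q f x = trans (sum-restrict-sub Q f (λ _ → x)) (+-congˡ (-‿cong (sum-restrict-const Q x)))

        -- A full `B₁` has `k` elements per job of `O₁`: those for `O₀` cover `B₀`, and each job of
        -- `N` brings `k` more.
        slots : ∣ B₁ ∣ ≡ k *ℕ ∣ O₁ ∣ → ∣ B₀ ∣ · θ + ∣ N ∣ · (k · θ) ≤ ∣ B₁ ∣ · θ
        slots ∣B₁∣≡ = ≤-respʳ-≈
          (sym (trans (×-congˡ ∣B₁∣≡) (trans (swap O₁) (∣O₁∣· (k · θ)))))
          (+-mono-≤ (≤-respʳ-≈ (swap O₀) (·-monoˡ-≤ (≤-trans 0≤c c≤θ) ∣B₀∣≤)) ≤-refl)
          where
          swap : (Q : Subset n) → (k *ℕ ∣ Q ∣) · θ ≈ ∣ Q ∣ · (k · θ)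
          swap Q = trans (×-congˡ (ℕ.*-comm k ∣ Q ∣)) (sym (×-assocˡ θ ∣ Q ∣ k))

          ∣B₀∣≤ : ∣ B₀ ∣ ℕ.≤ k *ℕ ∣ O₀ ∣
          ∣B₀∣≤ = ℕ.≤-trans (ℕ.≤-reflexive (IsLargest.card (B-largest t₀ 0≤t₀ (≤-trans t₀≤t₁ t₁≤t))))
                    (ℕ.m⊓n≤m (k *ℕ ∣ O₀ ∣) ∣ activeSet slf t₀ ∣)

    abstract
      slf-growth : k *ℕ ∣ O₁ ∣ ℕ.≤ ∣ activeSet slf t₁ ∣ →
                   volume slf B₀ t₀ + sum (restrict N size) ≤ volume slf B₁ t₁
      slf-growth m≤∣Q∣ =
        let θ , c≤θ , θ≤B₁ , ∉B₁≤θ = largest-threshold slf largest₁ λ j → active⇒c≤remaining ∘ ∈-activeSet⁻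
        in lin₂ (sum-gain c≤θ θ≤B₁ ∉B₁≤θ)
             (slots c≤θ θ≤B₁ ∉B₁≤θ (≡.trans (IsLargest.card largest₁) (ℕ.m≤n⇒m⊓n≡m m≤∣Q∣)))
             (solve 6 (λ v₀ p v₁ b₀ q b₁ →
                ((v₁ :- b₁) :- ((v₀ :- b₀) :+ (p :- q))) :+ (b₁ :- (b₀ :+ q)) := v₁ :- (v₀ :+ p)) refl
                (volume slf B₀ t₀) (sum (restrict N size)) (volume slf B₁ t₁)
                (∣ B₀ ∣ · θ) (∣ N ∣ · (k · θ)) (∣ B₁ ∣ · θ))
        where
        largest₁ : IsLargest slf t₁ (activeSet slf t₁) (k *ℕ ∣ O₁ ∣) B₁
        largest₁ = B-largest t₁ 0≤t₁ t₁≤t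

      volume-transfer : volume opt O₀ t₀ ≤ volume slf B₀ t₀ → volume opt O₁ t₁ ≤ volume slf B₁ t₁
      volume-transfer vol₀ with ℕ.≤-total (k *ℕ ∣ O₁ ∣) ∣ activeSet slf t₁ ∣
      ... | inj₁ m≤∣Q∣ = ≤-trans opt-growth
            (≤-trans (+-mono-≤ vol₀ ≤-refl) (slf-growth m≤∣Q∣))
      -- `B₁` now contains every active job, and volumes are compared at `t₁` alone.
      ... | inj₂ ∣Q∣≤m = volume-all-active slf opt busy-slf busy-opt 0≤t₁ t₁≤t B₁ O₁
            (λ j → largest-all slf (B-largest t₁ 0≤t₁ t₁≤t) ∣Q∣≤m ∘ ∈-activeSet⁺)
            (λ j → proj₂ ∘ O₁⇒active)

lemma3p6 :
    (ℝ : Reals) →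
    let open Reals ℝ
        open Scheduling ℝ
    in
    (ε : Carrier) → 0# < ε → ε < 1# →
    (⌈1/ε⌉ : ℕ) → IsCeiling (ε ⁻¹) ⌈1/ε⌉ →
    (I : Instance) (A : SLF ε I) (opt : Schedule I) → IsOptimal opt →
    let slf = SLF.schedule A in
    (t : Carrier) →
    NoIdlingUntil slf t → NoUnnecessaryIdling slf → NoUnnecessaryIdling opt →
    (B : Carrier → Subset (Instance.n I)) →
    (∀ s → 0# ≤ s → s ≤ t →
      IsLargest slf s (activeSet slf s) (⌈1/ε⌉ *ℕ ∣ activeAtBoth opt t s ∣) (B s)) →
    (t₀ t₁ : Carrier) → 0# ≤ t₀ → t₀ ≤ t₁ → t₁ ≤ t →
    volume opt (activeAtBoth opt t t₀) t₀ ≤ volume slf (B t₀) t₀ →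
    U A t₀ ≐ F A t t₀ →
    (L : Fin (Instance.n I)) → IsLeader A t t₁ L → L ∈ SLF.touched A t₁ →
    (∀ t′ → t₀ ≤ t′ → t′ ≤ t₁ → F A t t₀ ≐ F A t t′) →
    (∀ s → t₀ < s → s ≤ t₁ → Satisfiable (U A s ∖ U A t₀)) →
    volume opt (activeAtBoth opt t t₁) t₁ ≤ volume slf (B t₁) t₁
lemma3p6 ℝ ε 0<ε ε<1 k ceiling I A opt _ t busy-slf _ busy-opt B B-largest
         t₀ t₁ 0≤t₀ t₀≤t₁ t₁≤t vol₀ U≐F L leader L-touched F-const new-exists =
  Transfer.volume-transfer ℝ ε 0<ε ε<1 k ceiling A opt busy-slf busy-opt B B-largest
    0≤t₀ t₀≤t₁ t₁≤t U≐F leader L-touched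
    (F-const t₁ t₀≤t₁ (RealProperties.≤-refl ℝ)) new-exists vol₀
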